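{- Let $k\ge 2$ be an integer. For a real number $P\ge 1$, let $V_k^*(P)$ denote the number of pairs of integer $(k+1)$-tuples $\mathbf x=(x_1,\ldots,x_{k+1})$, $\mathbf y=(y_1,\ldots,y_{k+1})$ with $1\le x_i,y_i\le P$ $(1\le i\le k+1)$ satisfying \[ \sum_{i=1}^{k+1}x_i^{2j-1}=\sum_{i=1}^{k+1}y_i^{2j-1}\qquad (1\le j\le k), \] and let $L_k^*(P)$ denote the number of such pairs $(\mathbf x,\mathbf y)$ with $1\le x_i,y_i\le P$ in which $(x_1,\ldots,x_{k+1})$ is a permutation of $(y_1,\ldots,y_{k+1})$. Define \[ \alpha_k=\min_{\substack{r\in\mathbb N\\ 2\le r\le 2k+1}}\Bigl(r-1+\frac{2k+2}{r}\Bigr). \] Then for every $\varepsilon>0$ there is a constant $C=C(k,\varepsilon)$ such that for all $P\ge 1$, \[ V_k^*(P)-L_k^*(P)\le C P^{\alpha_k+\varepsilon}. \] In particular, for every $\varepsilon>0$ there is $C'=C'(k,\varepsilon)$ such that $V_k^*(P)-L_k^*(P)\le C' P^{\sqrt{8k+9}-1+\varepsilon}$ for all $P\ge 1$. -}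

module Defs where

open import Data.Nat using (ℕ; zero; suc; _+_; _*_; _∸_; _^_; _≤_)
open import Data.Integer using (ℤ; +_; ∣_∣)
open import Data.Rational using (ℚ; _/_; _⊓_; ↥_; ↧ₙ_)
import Data.Rational as Q
open import Data.List using (List; []; _∷_; map; concatMap; applyUpTo; foldr; cartesianProduct)
open import Data.Vec using (Vec; lookup)
import Data.Vec as V
open import Data.Fin using (Fin)
open import Data.Fin.Permutation using (Permutation′; _⟨$⟩ʳ_)
open import Data.Product using (Σ; _×_; _,_; ∃-syntax)
open import Relation.Binary.PropositionalEquality using (_≡_)
open import Relation.Nullary using (¬_)

-- Tuples (x_1,...,x_m) of integers with 1 ≤ x_i ≤ N, listed exhaustively.
-- (For real P ≥ 1 the condition 1 ≤ x_i ≤ P is the same as 1 ≤ x_i ≤ ⌊P⌋ = N.)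
box : ℕ → (m : ℕ) → List (Vec ℕ m)
box N zero    = V.[] ∷ []
box N (suc m) = concatMap (λ a → map (a V.∷_) (box N m)) (applyUpTo suc N)

pairs : (k : ℕ) → ℕ → List (Vec ℕ (suc k) × Vec ℕ (suc k))
pairs k N = cartesianProduct (box N (suc k)) (box N (suc k))

powSum : ∀ {m} → ℕ → Vec ℕ m → ℕ
powSum e x = V.sum (V.map (_^ e) x)

OddSystem : ℕ → ∀ {m} → Vec ℕ m × Vec ℕ m → Set
OddSystem k (x , y) = ∀ j → 1 ≤ j → j ≤ k → powSum (2 * j ∸ 1) x ≡ powSum (2 * j ∸ 1) y

IsPerm : ∀ {m} → Vec ℕ m × Vec ℕ m → Set
IsPerm {m} (x , y) = Σ (Permutation′ m) (λ σ → ∀ (i : Fin m) → lookup x i ≡ lookup y (σ ⟨$⟩ʳ i))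

data CountIs {A : Set} (P : A → Set) : List A → ℕ → Set where
  c-nil  : CountIs P [] 0
  c-yes  : ∀ {x xs n} → P x → CountIs P xs n → CountIs P (x ∷ xs) (suc n)
  c-no   : ∀ {x xs n} → ¬ P x → CountIs P xs n → CountIs P (x ∷ xs) n

VCount : ℕ → ℕ → ℕ → Set
VCount k N v = CountIs (OddSystem k) (pairs k N) v

LCount : ℕ → ℕ → ℕ → Set
LCount k N l = CountIs IsPerm (pairs k N) l

-- α_k = min_{2 ≤ r ≤ 2k+1} (r - 1 + (2k+2)/r); the term is indexed by r = suc r'.
alphaTerm : ℕ → ℕ → ℚ
alphaTerm k r' = (+ r' / 1) Q.+ (+ (2 * k + 2) / suc r')

alpha : ℕ → ℚ
alpha k = foldr _⊓_ (alphaTerm k 1) (map (alphaTerm k) (applyUpTo suc (2 * k)))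

-- V_k^*(P) - L_k^*(P) ≤ C P^e for all P ≥ 1, with rational exponent e = a/b,
-- written without real powers as  (V - L)^b ≤ C · N^a  for all integers N ≥ 1.
BoundedBy : ℕ → ℚ → Set
BoundedBy k e = ∃[ C ] (∀ N → 1 ≤ N → ∀ v l → VCount k N v → LCount k N l →
                   (v ∸ l) ^ (↧ₙ e) ≤ C * N ^ ∣ ↥ e ∣)

{-# OPTIONS --safe #-}
module Submission where

-- Put z = (x, -y), a list of 2k + 2 integers whose odd power sums of order up to 2k - 1 vanish.  By Newton's
-- identities the odd elementary symmetric functions of z of order up to 2k - 1 vanish, and then for every
-- entry t of z the product of t + z' over the remaining entries z' equals E = e_{2k+1}(z).  If E = 0 then some
-- x_1 = y_j can be cancelled, and x is a permutation of y by induction.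
--
-- Let E ≠ 0 and fix r distinct entries z_1, ..., z_r of z (if there are fewer than r distinct values there are
-- only O(N^r) solutions).  The numbers z_j + c, for c among the other q = 2k + 2 - r entries, form the
-- columns of r factorisations of E, up to known factors.  Process the columns one after the other, and
-- split off from z_j + c the part w_{j,c} that is new in the least common multiple of the partial products of the
-- rows.  The complementary parts divide known numbers.  Within a column the new parts may be taken
-- coprime, because a common divisor of z_i + c and z_j + c divides z_i - z_j.  Hence the product of all w_{j,c}
-- is at most (2N)^q, so some row m has W = ∏_c w_{m,c} ≤ (2N)^(q/r).  Given the z_j, m and W, each
-- further entry c is determined up to sign by divisors of W and of known numbers.  The divisor bound thus leaves
-- O(N^(r + q/r + ε)) solutions, and r + q/r = r - 1 + (2k + 2)/r.

open import Defs
open import Data.Empty using (⊥-elim)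
open import Data.Fin using (Fin; zero; suc; punchIn)
import Data.Fin.Permutation as Permutation
import Data.Fin.Properties as Fin
open import Data.Integer using (ℤ; +_; -[1+_]; ∣_∣; 0ℤ; 1ℤ)
  renaming (_+_ to _⊕_; _*_ to _⊛_; -_ to ⊖_; _^_ to _⊛^_)
import Data.Integer as ℤ
import Data.Integer.Divisibility.Signed as Signed
import Data.Integer.Properties as ℤ
import Data.Integer.Tactic.RingSolver as ℤSolver
open import Data.List using (List; []; _∷_; [_]; _++_; allFin; applyUpTo; concatMap; length; map; upTo)
import Data.List.Properties as List
import Data.List.Membership.DecPropositional as DecMembership
open import Data.List.Membership.Propositional using (_∈_; find)
open import Data.List.Membership.Propositional.Properties
  using (∈-++⁺ˡ; ∈-++⁺ʳ; ∈-++⁻; ∈-∃++; ∈-allFin; ∈-applyUpTo⁻; ∈-cartesianProduct⁻; ∈-concatMap⁻; ∈-map⁺; ∈-map⁻; ∈-upTo⁺; foldr-selective)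
open import Data.List.Relation.Binary.Permutation.Propositional
  using (_↭_; prep; swap; ↭-refl; ↭-sym; ↭-trans)
import Data.List.Relation.Binary.Permutation.Propositional as ↭
import Data.List.Relation.Binary.Permutation.Propositional.Properties as Perm
open import Data.List.Relation.Unary.All using (All; []; _∷_; all?)
import Data.List.Relation.Unary.All as All
import Data.List.Relation.Unary.All.Properties as All
open import Data.List.Relation.Unary.AllPairs using ([]; _∷_)
import Data.List.Relation.Unary.AllPairs as AllPairs
import Data.List.Relation.Unary.AllPairs.Properties as AllPairs
open import Data.List.Relation.Unary.Any using (here; there)
open import Data.List.Relation.Unary.Unique.Propositional using (Unique)
import Data.List.Relation.Unary.Unique.Propositional.Properties as Unique
open import Data.Nat
  using (ℕ; zero; suc; pred; _+_; _*_; _∸_; _^_; _≤_; _<_; z≤n; s≤s; _≟_; _≤?_; NonZero; >-nonZero; >-nonZero⁻¹; nonTrivial⇒n>1)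
import Data.Nat as ℕ
open import Data.Nat.Coprimality using (Coprime; coprime-divisor)
open import Data.Nat.Divisibility
open import Data.Nat.DivMod using (m%n<n; m≡m%n+[m/n]*n)
import Data.Nat.GCD as GCD
open import Data.Nat.LCM using (lcm; m∣lcm[m,n]; n∣lcm[m,n]; lcm-least)
open import Data.Nat.ListAction using (product)
open import Data.Nat.Primality using (Prime; prime⇒irreducible; prime⇒nonTrivial; prime⇒nonZero)
open import Data.Nat.Primality.Factorisation using (PrimeFactorisation; factorise)
import Data.Nat.Properties as ℕ
open import Data.Nat.Properties using (module ≤-Reasoning)
import Data.Nat.Tactic.RingSolver as ℕSolver
open import Data.Product using (Σ-syntax; ∃-syntax; _×_; _,_; proj₁; proj₂)
open import Data.Rational using (ℚ; 0ℚ; 1ℚ; _/_; ↥_; ↧ₙ_; toℚᵘ)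
import Data.Rational as Q
import Data.Rational.Properties as ℚ
open import Data.Rational.Unnormalised using (mkℚᵘ)
import Data.Rational.Unnormalised as ℚᵘ
import Data.Rational.Unnormalised.Properties as ℚᵘ
open import Data.Sum using (_⊎_; inj₁; inj₂)
open import Data.Unit using (⊤; tt)
open import Data.Vec using (Vec; lookup; removeAt; toList) renaming ([] to []ᵛ; _∷_ to _∷ᵛ_)
import Data.Vec.Properties as Vec
open import Data.Vec.Membership.Propositional.Properties using (∈-lookup; ∈-toList⁺; ∈-toList⁻)
import Data.Vec.Relation.Unary.Any as VecAny
import Data.Vec.Relation.Unary.Any.Properties as VecAny
open import Function using (_∘_)
open import Relation.Binary.PropositionalEquality
  using (_≡_; _≢_; refl; sym; trans; cong; cong₂; subst; subst₂; module ≡-Reasoning)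
open import Relation.Nullary using (Dec; yes; no; ¬_; _×-dec_)

-- Newton's identities

double : ℕ → ℕ
double zero    = zero
double (suc n) = suc (suc (double n))

esym : ℕ → List ℤ → ℤ
esym zero    _        = 1ℤ
esym (suc m) []       = 0ℤ
esym (suc m) (x ∷ xs) = esym (suc m) xs ⊕ x ⊛ esym m xs

psum : ℕ → List ℤ → ℤ
psum i []       = 0ℤ
psum i (x ∷ xs) = x ⊛^ i ⊕ psum i xs

-- mixed m i xs is the sum of x ^ (i + 1) times the m-th elementary symmetric
-- function of the other entries, over all entries x of xs.
mixed : ℕ → ℕ → List ℤ → ℤ
mixed m       i []       = 0ℤ
mixed zero    i (x ∷ xs) = x ⊛^ suc i ⊕ mixed zero i xs
mixed (suc m) i (x ∷ xs) = x ⊛^ suc i ⊛ esym (suc m) xs ⊕ mixed (suc m) i xs ⊕ x ⊛ mixed m i xs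

mixed-zero : ∀ i xs → mixed 0 i xs ≡ psum (suc i) xs
mixed-zero i []       = refl
mixed-zero i (x ∷ xs) = cong (x ⊛^ suc i ⊕_) (mixed-zero i xs)

-- Multiply out the right side and sort the products by the entry `x` that carries the power.
-- Monomials free of `x` form the first summand; those containing `x` raise its exponent by one and
-- form the second.
mixed-step : ∀ m i xs → mixed (suc m) i xs ⊕ mixed m (suc i) xs ≡ psum (suc i) xs ⊛ esym (suc m) xs
mixed-step m i [] = refl
mixed-step zero i (x ∷ xs) = begin
  X ⊛ e ⊕ a ⊕ x ⊛ b ⊕ (x ⊛ X ⊕ c)   ≡⟨ regroup X e a x b c ⟩
  (a ⊕ c) ⊕ x ⊛ b ⊕ X ⊛ e ⊕ x ⊛ X   ≡⟨ cong₂ (λ s t → s ⊕ x ⊛ t ⊕ X ⊛ e ⊕ x ⊛ X) (mixed-step zero i xs) (mixed-zero i xs) ⟩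
  p ⊛ e ⊕ x ⊛ p ⊕ X ⊛ e ⊕ x ⊛ X     ≡⟨ factor X e p x ⟩
  (X ⊕ p) ⊛ (e ⊕ x ⊛ 1ℤ)            ∎
  where
  open ≡-Reasoning
  X = x ⊛^ suc i
  e = esym 1 xs
  a = mixed 1 i xs
  b = mixed 0 i xs
  c = mixed 0 (suc i) xs
  p = psum (suc i) xs
  regroup : ∀ X e a x b c → X ⊛ e ⊕ a ⊕ x ⊛ b ⊕ (x ⊛ X ⊕ c) ≡ (a ⊕ c) ⊕ x ⊛ b ⊕ X ⊛ e ⊕ x ⊛ X
  regroup = ℤSolver.solve-∀
  factor : ∀ X e p x → p ⊛ e ⊕ x ⊛ p ⊕ X ⊛ e ⊕ x ⊛ X ≡ (X ⊕ p) ⊛ (e ⊕ x ⊛ 1ℤ)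
  factor = ℤSolver.solve-∀
mixed-step (suc m) i (x ∷ xs) = begin
  X ⊛ e ⊕ a ⊕ x ⊛ b ⊕ (x ⊛ X ⊛ f ⊕ c ⊕ x ⊛ d)   ≡⟨ regroup X e a x b c d f ⟩
  (a ⊕ c) ⊕ x ⊛ (b ⊕ d) ⊕ X ⊛ e ⊕ x ⊛ X ⊛ f     ≡⟨ cong₂ (λ s t → s ⊕ x ⊛ t ⊕ X ⊛ e ⊕ x ⊛ X ⊛ f) (mixed-step (suc m) i xs) (mixed-step m i xs) ⟩
  p ⊛ e ⊕ x ⊛ (p ⊛ f) ⊕ X ⊛ e ⊕ x ⊛ X ⊛ f       ≡⟨ factor X e f p x ⟩
  (X ⊕ p) ⊛ (e ⊕ x ⊛ f)                          ∎
  where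
  open ≡-Reasoning
  X = x ⊛^ suc i
  e = esym (suc (suc m)) xs
  f = esym (suc m) xs
  a = mixed (suc (suc m)) i xs
  b = mixed (suc m) i xs
  c = mixed (suc m) (suc i) xs
  d = mixed m (suc i) xs
  p = psum (suc i) xs
  regroup : ∀ X e a x b c d f → X ⊛ e ⊕ a ⊕ x ⊛ b ⊕ (x ⊛ X ⊛ f ⊕ c ⊕ x ⊛ d) ≡ (a ⊕ c) ⊕ x ⊛ (b ⊕ d) ⊕ X ⊛ e ⊕ x ⊛ X ⊛ f
  regroup = ℤSolver.solve-∀
  factor : ∀ X e f p x → p ⊛ e ⊕ x ⊛ (p ⊛ f) ⊕ X ⊛ e ⊕ x ⊛ X ⊛ f ≡ (X ⊕ p) ⊛ (e ⊕ x ⊛ f)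
  factor = ℤSolver.solve-∀

-- Each monomial of the elementary symmetric function is produced once by each of its `m + 1`
-- variables.
mixed-esym : ∀ m xs → mixed m 0 xs ≡ + suc m ⊛ esym (suc m) xs
mixed-esym m [] = sym (ℤ.*-zeroʳ (+ suc m))
mixed-esym zero (x ∷ xs) = begin
  x ⊛ 1ℤ ⊕ mixed 0 0 xs          ≡⟨ cong (x ⊛ 1ℤ ⊕_) (mixed-esym 0 xs) ⟩
  x ⊛ 1ℤ ⊕ 1ℤ ⊛ esym 1 xs        ≡⟨ identity x (esym 1 xs) ⟩
  1ℤ ⊛ (esym 1 xs ⊕ x ⊛ 1ℤ)      ∎
  where
  open ≡-Reasoning
  identity : ∀ x e → x ⊛ 1ℤ ⊕ 1ℤ ⊛ e ≡ 1ℤ ⊛ (e ⊕ x ⊛ 1ℤ)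
  identity = ℤSolver.solve-∀
mixed-esym (suc m) (x ∷ xs) = begin
  x ⊛ 1ℤ ⊛ f ⊕ mixed (suc m) 0 xs ⊕ x ⊛ mixed m 0 xs
    ≡⟨ cong₂ (λ s t → x ⊛ 1ℤ ⊛ f ⊕ s ⊕ x ⊛ t) (mixed-esym (suc m) xs) (mixed-esym m xs) ⟩
  x ⊛ 1ℤ ⊛ f ⊕ (1ℤ ⊕ + suc m) ⊛ e ⊕ x ⊛ (+ suc m ⊛ f)
    ≡⟨ identity x f e (+ suc m) ⟩
  (1ℤ ⊕ + suc m) ⊛ (e ⊕ x ⊛ f) ∎
  where
  open ≡-Reasoning
  e = esym (suc (suc m)) xs
  f = esym (suc m) xs
  identity : ∀ x f e n → x ⊛ 1ℤ ⊛ f ⊕ (1ℤ ⊕ n) ⊛ e ⊕ x ⊛ (n ⊛ f) ≡ (1ℤ ⊕ n) ⊛ (e ⊕ x ⊛ f)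
  identity = ℤSolver.solve-∀

sum-zero : ∀ {a b c} → a ⊕ b ≡ c → b ≡ 0ℤ → c ≡ 0ℤ → a ≡ 0ℤ
sum-zero {a} refl refl eq = trans (sym (ℤ.+-identityʳ a)) eq

module _ (k : ℕ) (xs : List ℤ) (odd-psum : ∀ j → j < k → psum (suc (double j)) xs ≡ 0ℤ) where

  -- Mutual induction on the order. Two uses of `mixed-step` lead from the indices 2a + 2, 2b to the
  -- indices 2a, 2b + 2, because each right side contains an odd power sum or an odd elementary
  -- function already known to vanish. The chain ends at the power sum of order 2(a + b) + 1. The
  -- factor 2j + 1 is then cancelled in the integers.
  esym-odd : ∀ j → j < k → esym (suc (double j)) xs ≡ 0ℤ
  mixed-even : ∀ a b → a + b < k → mixed (double a) (double b) xs ≡ 0ℤ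

  esym-odd j j<k = ℤ.*-cancelˡ-≡ (+ suc (double j)) _ _
    (trans (sym (mixed-esym (double j) xs))
      (trans (mixed-even j 0 (subst (_< k) (sym (ℕ.+-identityʳ j)) j<k))
        (sym (ℤ.*-zeroʳ (+ suc (double j))))))

  mixed-even zero b b<k = trans (mixed-zero (double b) xs) (odd-psum b b<k)
  mixed-even (suc a) b a+b<k =
    sum-zero (mixed-step (suc (double a)) (double b) xs)
      (sum-zero (mixed-step (double a) (suc (double b)) xs)
        (mixed-even a (suc b) (subst (_< k) (sym (ℕ.+-suc a b)) a+b<k))
        (trans (cong (psum (suc (suc (double b))) xs ⊛_) (esym-odd a (ℕ.≤-<-trans (ℕ.m≤m+n a b) (ℕ.<-trans (ℕ.n<1+n _) a+b<k))))
          (ℤ.*-zeroʳ (psum (suc (suc (double b))) xs))))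
      (cong (_⊛ esym (suc (suc (double a))) xs) (odd-psum b (ℕ.≤-<-trans (ℕ.m≤n+m b (suc a)) a+b<k)))

-- The m + 1 leading terms of ∏ (t + x) over xs, divided by the surplus power of t.
horner : ℕ → List ℤ → ℤ → ℤ
horner zero    xs t = 1ℤ
horner (suc m) xs t = t ⊛ horner m xs t ⊕ esym (suc m) xs

shiftProduct : ℤ → List ℤ → ℤ
shiftProduct t []       = 1ℤ
shiftProduct t (x ∷ xs) = (t ⊕ x) ⊛ shiftProduct t xs

esym-above : ∀ m xs → length xs < m → esym m xs ≡ 0ℤ
esym-above (suc m) []       _         = refl
esym-above (suc m) (x ∷ xs) (s≤s l<m) = begin
  esym (suc m) xs ⊕ x ⊛ esym m xs ≡⟨ cong₂ (λ s t → s ⊕ x ⊛ t) (esym-above (suc m) xs (ℕ.<-trans l<m (ℕ.n<1+n m))) (esym-above m xs l<m) ⟩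
  0ℤ ⊕ x ⊛ 0ℤ                     ≡⟨ cong (0ℤ ⊕_) (ℤ.*-zeroʳ x) ⟩
  0ℤ                              ∎
  where open ≡-Reasoning

horner-cons : ∀ m x xs t → horner (suc m) (x ∷ xs) t ≡ horner (suc m) xs t ⊕ x ⊛ horner m xs t
horner-cons zero x xs t = identity t (esym 1 xs) x
  where
  identity : ∀ t e x → t ⊛ 1ℤ ⊕ (e ⊕ x ⊛ 1ℤ) ≡ t ⊛ 1ℤ ⊕ e ⊕ x ⊛ 1ℤ
  identity = ℤSolver.solve-∀
horner-cons (suc m) x xs t = trans (cong (λ h → t ⊛ h ⊕ (e ⊕ x ⊛ f)) (horner-cons m x xs t))
    (identity t (horner (suc m) xs t) x (horner m xs t) e f)
  where
  e = esym (suc (suc m)) xs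
  f = esym (suc m) xs
  identity : ∀ t h x g e f → t ⊛ (h ⊕ x ⊛ g) ⊕ (e ⊕ x ⊛ f) ≡ t ⊛ h ⊕ e ⊕ x ⊛ (t ⊛ g ⊕ f)
  identity = ℤSolver.solve-∀

horner-length : ∀ xs t → horner (length xs) xs t ≡ shiftProduct t xs
horner-length []       t = refl
horner-length (x ∷ xs) t = begin
  horner (suc l) (x ∷ xs) t                ≡⟨ horner-cons l x xs t ⟩
  t ⊛ h ⊕ esym (suc l) xs ⊕ x ⊛ h          ≡⟨ cong (λ s → t ⊛ h ⊕ s ⊕ x ⊛ h) (esym-above (suc l) xs (ℕ.n<1+n l)) ⟩
  t ⊛ h ⊕ 0ℤ ⊕ x ⊛ h                       ≡⟨ identity t h x ⟩
  (t ⊕ x) ⊛ h                              ≡⟨ cong ((t ⊕ x) ⊛_) (horner-length xs t) ⟩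
  (t ⊕ x) ⊛ shiftProduct t xs              ∎
  where
  open ≡-Reasoning
  l = length xs
  h = horner l xs t
  identity : ∀ t h x → t ⊛ h ⊕ 0ℤ ⊕ x ⊛ h ≡ (t ⊕ x) ⊛ h
  identity = ℤSolver.solve-∀

-- By induction the Horner value two orders lower is an odd elementary function of `t ∷ xs`, hence
-- 0. The last two terms survive, and they expand the next odd elementary function along `t`.
horner-odd : ∀ k t xs → (∀ j → j < k → esym (suc (double j)) (t ∷ xs) ≡ 0ℤ) →
             horner (suc (double k)) xs t ≡ esym (suc (double k)) (t ∷ xs)
horner-odd zero t xs odd = ℤ.+-comm (t ⊛ 1ℤ) (esym 1 xs)
horner-odd (suc k) t xs odd = begin
  t ⊛ (t ⊛ horner (suc (double k)) xs t ⊕ f) ⊕ e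
    ≡⟨ cong (λ h → t ⊛ (t ⊛ h ⊕ f) ⊕ e) (trans (horner-odd k t xs (λ j j<k → odd j (ℕ.<-trans j<k (ℕ.n<1+n k)))) (odd k (ℕ.n<1+n k))) ⟩
  t ⊛ (t ⊛ 0ℤ ⊕ f) ⊕ e
    ≡⟨ identity t e f ⟩
  e ⊕ t ⊛ f ∎
  where
  open ≡-Reasoning
  e = esym (suc (suc (suc (double k)))) xs
  f = esym (suc (suc (double k))) xs
  identity : ∀ t e f → t ⊛ (t ⊛ 0ℤ ⊕ f) ⊕ e ≡ e ⊕ t ⊛ f
  identity = ℤSolver.solve-∀

OddPowerSumsVanish : ℕ → List ℤ → Set
OddPowerSumsVanish k zs = ∀ j → j < k → psum (suc (double j)) zs ≡ 0ℤ

-- The right side is symmetric in all entries, so every choice of `t` in a given list yields a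
-- factorisation of the same integer.
row-product : ∀ k t xs → length xs ≡ suc (double k) → OddPowerSumsVanish k (t ∷ xs) →
              shiftProduct t xs ≡ esym (suc (double k)) (t ∷ xs)
row-product k t xs len odd = begin
  shiftProduct t xs            ≡⟨ horner-length xs t ⟨
  horner (length xs) xs t      ≡⟨ cong (λ l → horner l xs t) len ⟩
  horner (suc (double k)) xs t ≡⟨ horner-odd k t xs (esym-odd k (t ∷ xs) odd) ⟩
  esym (suc (double k)) (t ∷ xs) ∎
  where open ≡-Reasoning

esym-↭ : ∀ m {xs ys} → xs ↭ ys → esym m xs ≡ esym m ys
esym-↭ zero    _            = refl
esym-↭ (suc m) ↭.refl         = refl
esym-↭ (suc m) (prep x p)   = cong₂ (λ s t → s ⊕ x ⊛ t) (esym-↭ (suc m) p) (esym-↭ m p)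
esym-↭ (suc m) (↭.trans p q)  = trans (esym-↭ (suc m) p) (esym-↭ (suc m) q)
esym-↭ (suc zero) (swap {xs} {ys} x y p) = trans (identity (esym 1 xs) x y)
    (cong (λ s → s ⊕ x ⊛ 1ℤ ⊕ y ⊛ 1ℤ) (esym-↭ 1 p))
  where
  identity : ∀ e x y → e ⊕ y ⊛ 1ℤ ⊕ x ⊛ 1ℤ ≡ e ⊕ x ⊛ 1ℤ ⊕ y ⊛ 1ℤ
  identity = ℤSolver.solve-∀
esym-↭ (suc (suc m)) (swap {xs} {ys} x y p) = trans (identity (esym (suc (suc m)) xs) (esym (suc m) xs) (esym m xs) x y)
    (cong₂ (λ e (f , g) → e ⊕ x ⊛ f ⊕ y ⊛ (f ⊕ x ⊛ g)) (esym-↭ (suc (suc m)) p) (cong₂ _,_ (esym-↭ (suc m) p) (esym-↭ m p)))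
  where
  identity : ∀ e f g x y → e ⊕ y ⊛ f ⊕ x ⊛ (f ⊕ y ⊛ g) ≡ e ⊕ x ⊛ f ⊕ y ⊛ (f ⊕ x ⊛ g)
  identity = ℤSolver.solve-∀

psum-↭ : ∀ i {xs ys} → xs ↭ ys → psum i xs ≡ psum i ys
psum-↭ i ↭.refl         = refl
psum-↭ i (prep x p)   = cong (x ⊛^ i ⊕_) (psum-↭ i p)
psum-↭ i (↭.trans p q)  = trans (psum-↭ i p) (psum-↭ i q)
psum-↭ i (swap {xs} {ys} x y p) = trans (identity (x ⊛^ i) (y ⊛^ i) (psum i xs)) (cong (λ s → y ⊛^ i ⊕ (x ⊛^ i ⊕ s)) (psum-↭ i p))
  where
  identity : ∀ a b s → a ⊕ (b ⊕ s) ≡ b ⊕ (a ⊕ s)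
  identity = ℤSolver.solve-∀

-- Diagonal solutions

⊖-⊛^-odd : ∀ x j → (⊖ x) ⊛^ suc (double j) ≡ ⊖ (x ⊛^ suc (double j))
⊖-⊛^-odd x zero    = identity x
  where
  identity : ∀ x → (⊖ x) ⊛ 1ℤ ≡ ⊖ (x ⊛ 1ℤ)
  identity = ℤSolver.solve-∀
⊖-⊛^-odd x (suc j) = trans (cong (λ p → (⊖ x) ⊛ ((⊖ x) ⊛ p)) (⊖-⊛^-odd x j)) (identity x _)
  where
  identity : ∀ x p → (⊖ x) ⊛ ((⊖ x) ⊛ (⊖ p)) ≡ ⊖ (x ⊛ (x ⊛ p))
  identity = ℤSolver.solve-∀

signed : List ℕ → List ℕ → List ℤ
signed xs ys = map +_ xs ++ map (λ y → ⊖ (+ y)) ys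

signed-length : ∀ {xs ys m n} → length xs ≡ m → length ys ≡ n → length (signed xs ys) ≡ m + n
signed-length {xs} {ys} refl refl = trans (List.length-++ (map +_ xs))
  (cong₂ _+_ (List.length-map +_ xs) (List.length-map _ ys))

double≡+ : ∀ m → double m ≡ m + m
double≡+ zero    = refl
double≡+ (suc m) = cong suc (trans (cong suc (double≡+ m)) (sym (ℕ.+-suc m m)))

signed-shift : ∀ x xs as bs → signed (x ∷ xs) (as ++ [ x ] ++ bs) ↭ + x ∷ ⊖ (+ x) ∷ signed xs (as ++ bs)
signed-shift x xs as bs = prep (+ x) (↭-trans
  (Perm.++⁺ˡ (map +_ xs) (Perm.map⁺ (λ y → ⊖ (+ y)) (Perm.shift x as bs)))
  (Perm.shift (⊖ (+ x)) (map +_ xs) (map (λ y → ⊖ (+ y)) (as ++ bs))))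

signed-remove : ∀ k {x xs as bs} → OddPowerSumsVanish k (signed (x ∷ xs) (as ++ [ x ] ++ bs)) →
                OddPowerSumsVanish k (signed xs (as ++ bs))
signed-remove k {x} {xs} {as} {bs} odd j j<k = begin
  s                              ≡⟨ identity p s ⟩
  p ⊕ (⊖ p ⊕ s)                  ≡⟨ cong (λ q → p ⊕ (q ⊕ s)) (⊖-⊛^-odd (+ x) j) ⟨
  psum i (+ x ∷ ⊖ (+ x) ∷ signed xs (as ++ bs)) ≡⟨ psum-↭ i (signed-shift x xs as bs) ⟨
  psum i (signed (x ∷ xs) (as ++ [ x ] ++ bs))  ≡⟨ odd j j<k ⟩
  0ℤ                             ∎
  where
  open ≡-Reasoning
  i = suc (double j)
  p = (+ x) ⊛^ i
  s = psum i (signed xs (as ++ bs))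
  identity : ∀ p s → s ≡ p ⊕ (⊖ p ⊕ s)
  identity = ℤSolver.solve-∀

shiftProduct-zero : ∀ t xs → shiftProduct t xs ≡ 0ℤ → ∃[ x ] x ∈ xs × t ⊕ x ≡ 0ℤ
shiftProduct-zero t (x ∷ xs) eq with ℤ.i*j≡0⇒i≡0∨j≡0 (t ⊕ x) eq
... | inj₁ t+x≡0 = x , here refl , t+x≡0
... | inj₂ rest with shiftProduct-zero t xs rest
...   | y , y∈xs , t+y≡0 = y , there y∈xs , t+y≡0

-- Since `+ x` is positive, its negative cannot lie in the first half, whose entries are
-- nonnegative.
opposite-in-signed : ∀ {x xs ys z} → 1 ≤ x → z ∈ signed xs ys → + x ⊕ z ≡ 0ℤ → x ∈ ys
opposite-in-signed {x} {xs} 1≤x z∈ eq with ∈-++⁻ (map +_ xs) z∈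
... | inj₁ z∈xs with ∈-map⁻ +_ z∈xs
opposite-in-signed (s≤s _) _ () | inj₁ _ | _ , _ , refl
opposite-in-signed {x} {ys = ys} 1≤x z∈ eq | inj₂ z∈ys with ∈-map⁻ (λ y → ⊖ (+ y)) z∈ys
... | y , y∈ys , refl = subst (_∈ ys) (sym (ℤ.+-injective (ℤ.i-j≡0⇒i≡j (+ x) (+ y) eq))) y∈ys

-- With as many equations as entries on each side, Newton's identities already make the needed
-- elementary function vanish; with one equation fewer its vanishing is assumed. Cancelling one
-- common entry leads from the second situation back to the first.
odd-system⇒↭ : ∀ m {xs ys} → All (1 ≤_) xs → length xs ≡ m → length ys ≡ m →
               OddPowerSumsVanish m (signed xs ys) → xs ↭ ys
odd-system+esym⇒↭ : ∀ m {xs ys} → All (1 ≤_) xs → length xs ≡ suc m → length ys ≡ suc m →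
  OddPowerSumsVanish m (signed xs ys) → esym (suc (double m)) (signed xs ys) ≡ 0ℤ → xs ↭ ys

odd-system⇒↭ zero    {[]} {[]} _ _ _ _ = ↭-refl
odd-system⇒↭ (suc m) {xs} {ys} pos lx ly odd = odd-system+esym⇒↭ m pos lx ly
  (λ j j<m → odd j (ℕ.<-trans j<m (ℕ.n<1+n m))) (esym-odd (suc m) (signed xs ys) odd m (ℕ.n<1+n m))

odd-system+esym⇒↭ m {x ∷ xs} {ys} (1≤x ∷ pos) lx ly odd e≡0
  with shiftProduct-zero (+ x) (signed xs ys) (trans (row-product m (+ x) (signed xs ys) len odd) e≡0)
  where
  len : length (signed xs ys) ≡ suc (double m)
  len = trans (signed-length {xs} {ys} (ℕ.suc-injective lx) ly) (trans (ℕ.+-suc m m) (cong suc (sym (double≡+ m))))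
... | z , z∈ , x+z≡0 with ∈-∃++ (opposite-in-signed {x} {xs} {ys} 1≤x z∈ x+z≡0)
...   | as , bs , refl = ↭-trans
  (prep x (odd-system⇒↭ m pos (ℕ.suc-injective lx) (ℕ.suc-injective (trans (sym (Perm.↭-length (Perm.shift x as bs))) ly))
    (signed-remove m {x} {xs} {as} odd)))
  (↭-sym (Perm.shift x as bs))

toList-removeAt : ∀ {A : Set} {m} (y : Vec A (suc m)) j → toList y ↭ lookup y j ∷ toList (removeAt y j)
toList-removeAt (y ∷ᵛ ys)            zero    = ↭-refl
toList-removeAt (y ∷ᵛ ys@(_ ∷ᵛ _))   (suc j) = ↭-trans (prep y (toList-removeAt ys j)) (swap y _ ↭-refl)

lookup-removeAt : ∀ {m} (y : Vec ℕ (suc m)) j i → lookup (removeAt y j) i ≡ lookup y (punchIn j i)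
lookup-removeAt (y ∷ᵛ ys)          zero    i       = refl
lookup-removeAt (y ∷ᵛ ys@(_ ∷ᵛ _)) (suc j) zero    = refl
lookup-removeAt (y ∷ᵛ ys@(_ ∷ᵛ _)) (suc j) (suc i) = lookup-removeAt ys j i

↭⇒IsPerm : ∀ {m} (x y : Vec ℕ m) → toList x ↭ toList y → IsPerm (x , y)
↭⇒IsPerm []ᵛ        []ᵛ         _ = Permutation.id , λ ()
↭⇒IsPerm (x ∷ᵛ xs) y@(_ ∷ᵛ _) p = Permutation.insert zero j (proj₁ tail) , agrees
  where
  x∈y = ∈-toList⁻ (Perm.∈-resp-↭ p (here refl))
  j = VecAny.index x∈y
  x≡yⱼ : x ≡ lookup y j
  x≡yⱼ = VecAny.lookup-index x∈y
  tail : IsPerm (xs , removeAt y j)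
  tail = ↭⇒IsPerm xs (removeAt y j) (Perm.drop-∷ (↭-trans p (subst (λ z → toList y ↭ z ∷ toList (removeAt y j)) (sym x≡yⱼ) (toList-removeAt y j))))
  agrees : ∀ i → lookup (x ∷ᵛ xs) i ≡ lookup y (Permutation.insert zero j (proj₁ tail) Permutation.⟨$⟩ʳ i)
  agrees zero    = x≡yⱼ
  agrees (suc i) = trans (proj₂ tail i) (trans (lookup-removeAt y j _)
    (cong (lookup y) (sym (Permutation.insert-punchIn zero j (proj₁ tail) i))))

psum-++ : ∀ i xs ys → psum i (xs ++ ys) ≡ psum i xs ⊕ psum i ys
psum-++ i []       ys = sym (ℤ.+-identityˡ _)
psum-++ i (x ∷ xs) ys = trans (cong (x ⊛^ i ⊕_) (psum-++ i xs ys)) (sym (ℤ.+-assoc (x ⊛^ i) _ _))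

pos-^ : ∀ x i → (+ x) ⊛^ i ≡ + (x ^ i)
pos-^ x zero    = refl
pos-^ x (suc i) = trans (cong (+ x ⊛_) (pos-^ x i)) (sym (ℤ.pos-* x (x ^ i)))

psum-pos : ∀ {m} i (x : Vec ℕ m) → psum i (map +_ (toList x)) ≡ + powSum i x
psum-pos i []ᵛ       = refl
psum-pos i (x ∷ᵛ xs) = cong₂ _⊕_ (pos-^ x i) (psum-pos i xs)

psum-neg : ∀ {m} j (y : Vec ℕ m) → psum (suc (double j)) (map (λ y → ⊖ (+ y)) (toList y)) ≡ ⊖ (+ powSum (suc (double j)) y)
psum-neg j []ᵛ       = refl
psum-neg j (y ∷ᵛ ys) = trans
  (cong₂ _⊕_ (trans (⊖-⊛^-odd (+ y) j) (cong ⊖_ (pos-^ y (suc (double j))))) (psum-neg j ys))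
  (sym (ℤ.neg-distrib-+ (+ (y ^ suc (double j))) _))

odd-exponent : ∀ j → 2 * suc j ∸ 1 ≡ suc (double j)
odd-exponent j = trans (ℕ.+-suc j (j + 0)) (cong suc (trans (cong (λ i → j + i) (ℕ.+-identityʳ j)) (sym (double≡+ j))))

OddSystem⇒vanish : ∀ k {m} (x y : Vec ℕ m) → OddSystem k (x , y) → OddPowerSumsVanish k (signed (toList x) (toList y))
OddSystem⇒vanish k x y odd j j<k = begin
  psum i (signed (toList x) (toList y))
    ≡⟨ psum-++ i (map +_ (toList x)) _ ⟩
  psum i (map +_ (toList x)) ⊕ psum i (map (λ y → ⊖ (+ y)) (toList y))
    ≡⟨ cong₂ _⊕_ (psum-pos i x) (psum-neg j y) ⟩
  + powSum i x ⊕ ⊖ (+ powSum i y)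
    ≡⟨ cong (λ s → + s ⊕ ⊖ (+ powSum i y)) (subst (λ e → powSum e x ≡ powSum e y) (odd-exponent j) (odd (suc j) (s≤s z≤n) j<k)) ⟩
  + powSum i y ⊕ ⊖ (+ powSum i y)
    ≡⟨ ℤ.+-inverseʳ (+ powSum i y) ⟩
  0ℤ ∎
  where
  open ≡-Reasoning
  i = suc (double j)

-- Cardinality bounds and the divisor function

-- A cover by a list, which may repeat members or contain others; such covers compose under unions,
-- images and dependent choices.
AtMost : {A : Set} → (A → Set) → ℕ → Set
AtMost {A} P n = Σ[ xs ∈ List A ] length xs ≤ n × (∀ a → P a → a ∈ xs)

module _ {A : Set} {P : A → Set} where

  atMost-⊆ : ∀ {Q : A → Set} {n} → (∀ a → Q a → P a) → AtMost P n → AtMost Q n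
  atMost-⊆ Q⊆P (xs , len , mem) = xs , len , λ a Qa → mem a (Q⊆P a Qa)

  atMost-≤ : ∀ {m n} → m ≤ n → AtMost P m → AtMost P n
  atMost-≤ m≤n (xs , len , mem) = xs , ℕ.≤-trans len m≤n , mem

  atMost-⊎ : ∀ {Q : A → Set} {m n} → AtMost P m → AtMost Q n → AtMost (λ a → P a ⊎ Q a) (m + n)
  atMost-⊎ (xs , len , mem) (ys , len′ , mem′) = xs ++ ys ,
    subst (_≤ _) (sym (List.length-++ xs)) (ℕ.+-mono-≤ len len′) ,
    λ where a (inj₁ Pa) → ∈-++⁺ˡ (mem a Pa)
            a (inj₂ Qa) → ∈-++⁺ʳ xs (mem′ a Qa)

  -- Makes a bound that is available only under `R` usable for every choice of parameters: where `R`
  -- fails, the family is empty.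
  atMost-guard : ∀ {R : Set} {n} → Dec R → (R → AtMost P n) → AtMost (λ a → R × P a) n
  atMost-guard (yes r) f = atMost-⊆ (λ _ → proj₂) (f r)
  atMost-guard (no ¬r) f = [] , z≤n , λ a Ra → ⊥-elim (¬r (proj₁ Ra))

  atMost-image : ∀ {B : Set} {n} (f : A → B) → AtMost P n → AtMost (λ b → ∃[ a ] P a × b ≡ f a) n
  atMost-image f (xs , len , mem) = map f xs , subst (_≤ _) (sym (List.length-map f xs)) len ,
    λ where _ (a , Pa , refl) → ∈-map⁺ f (mem a Pa)

  atMost-bind : ∀ {B : Set} {Q : A → B → Set} {m n} → AtMost P m → (∀ a → AtMost (Q a) n) →
                AtMost (λ b → ∃[ a ] P a × Q a b) (m * n)
  atMost-bind {B} {Q} {m} {n} (xs , len , mem) f =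
    concatMap g xs , ℕ.≤-trans (bounded xs) (ℕ.*-monoˡ-≤ n len) , λ b (a , Pa , Qab) → member xs (mem a Pa) Qab
    where
    g : A → List B
    g a = proj₁ (f a)
    bounded : ∀ xs → length (concatMap g xs) ≤ length xs * n
    bounded []       = z≤n
    bounded (x ∷ xs) = subst (_≤ _) (sym (List.length-++ (g x))) (ℕ.+-mono-≤ (proj₁ (proj₂ (f x))) (bounded xs))
    member : ∀ {a b} xs → a ∈ xs → Q a b → b ∈ concatMap g xs
    member (x ∷ xs) (here refl) Qab = ∈-++⁺ˡ (proj₂ (proj₂ (f x)) _ Qab)
    member (x ∷ xs) (there a∈)  Qab = ∈-++⁺ʳ (g x) (member xs a∈ Qab)

atMost-≤-upTo : ∀ n → AtMost (_≤ n) (suc n)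
atMost-≤-upTo n = upTo (suc n) , ℕ.≤-reflexive (List.length-upTo (suc n)) , λ a a≤n → ∈-upTo⁺ (s≤s a≤n)

DivisorBound : ℕ → ℕ → Set
DivisorBound n t = AtMost (_∣ n) t

prime∤⇒coprime : ∀ {p d} → Prime p → ¬ (p ∣ d) → Coprime d p
prime∤⇒coprime {p} {d} pp p∤d (c∣d , c∣p) with prime⇒irreducible pp c∣p
... | inj₁ c≡1 = c≡1
... | inj₂ c≡p = ⊥-elim (p∤d (subst (_∣ d) c≡p c∣d))

-- Powers of `p` are peeled off one at a time: if `p` does not divide `d`, coprimality removes it
-- from the right; otherwise it is cancelled on both sides.
divisor-prime-power : ∀ {p} → Prime p → ∀ e {d m} → d ∣ p ^ e * m →
                      ∃[ i ] i ≤ e × (∃[ c ] c ∣ m × d ≡ p ^ i * c)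
divisor-prime-power pp zero {d} d∣ = 0 , z≤n , d , subst (d ∣_) (ℕ.+-identityʳ _) d∣ , sym (ℕ.+-identityʳ d)
divisor-prime-power {p} pp (suc e) {d} {m} d∣ with p ∣? d
... | no p∤d with divisor-prime-power pp e (coprime-divisor (prime∤⇒coprime pp p∤d) (subst (d ∣_) (ℕ.*-assoc p (p ^ e) m) d∣))
...   | i , i≤e , c , c∣m , eq = i , ℕ.≤-trans i≤e (ℕ.n≤1+n e) , c , c∣m , eq
divisor-prime-power {p} pp (suc e) {d} {m} d∣ | yes (divides d′ refl)
  with divisor-prime-power pp e {d′} {m} (*-cancelˡ-∣ p {{prime⇒nonZero pp}}
         (subst (_∣ p * (p ^ e * m)) (ℕ.*-comm d′ p) (subst (d′ * p ∣_) (ℕ.*-assoc p (p ^ e) m) d∣)))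
... | i , i≤e , c , c∣m , refl = suc i , s≤s i≤e , c , c∣m , identity p (p ^ i) c
  where
  identity : ∀ p q c → q * c * p ≡ p * q * c
  identity = ℕSolver.solve-∀

divisorBound-prime-power : ∀ {p} → Prime p → ∀ e {m t} → DivisorBound m t → DivisorBound (p ^ e * m) (suc e * t)
divisorBound-prime-power {p} pp e bound = atMost-⊆ (λ d → divisor-prime-power pp e)
  (atMost-bind (atMost-≤-upTo e) (λ i → atMost-image (p ^ i *_) bound))

n<2^n : ∀ n → n < 2 ^ n
n<2^n zero    = s≤s z≤n
n<2^n (suc n) = begin
  suc (suc n)       ≤⟨ s≤s (n<2^n n) ⟩
  suc (2 ^ n)       ≤⟨ ℕ.+-monoˡ-≤ (2 ^ n) (ℕ.m^n>0 2 n) ⟩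
  2 ^ n + 2 ^ n     ≡⟨ cong (λ m → 2 ^ n + m) (ℕ.+-identityʳ (2 ^ n)) ⟨
  2 ^ suc n         ∎
  where open ≤-Reasoning

^-distribʳ-* : ∀ h m n → (m * n) ^ h ≡ m ^ h * n ^ h
^-distribʳ-* zero    m n = refl
^-distribʳ-* (suc h) m n = trans (cong (m * n *_) (^-distribʳ-* h m n)) (identity m n (m ^ h) (n ^ h))
  where
  identity : ∀ m n a b → m * n * (a * b) ≡ m * a * (n * b)
  identity = ℕSolver.solve-∀

-- With f the integer part of e / h, one has e + 1 ≤ h (f + 1) ≤ h 2^f, and f h ≤ e.
suc^≤2^ : ∀ h .{{_ : NonZero h}} e → suc e ^ h ≤ h ^ h * 2 ^ e
suc^≤2^ h e = begin
  suc e ^ h               ≤⟨ ℕ.^-monoˡ-≤ h base ⟩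
  (h * 2 ^ f) ^ h         ≡⟨ ^-distribʳ-* h h (2 ^ f) ⟩
  h ^ h * (2 ^ f) ^ h     ≡⟨ cong (h ^ h *_) (ℕ.^-*-assoc 2 f h) ⟩
  h ^ h * 2 ^ (f * h)     ≤⟨ ℕ.*-monoʳ-≤ (h ^ h) (ℕ.^-monoʳ-≤ 2 fh≤e) ⟩
  h ^ h * 2 ^ e           ∎
  where
  open ≤-Reasoning
  f = e ℕ./ h
  fh≤e : f * h ≤ e
  fh≤e = subst (f * h ≤_) (sym (m≡m%n+[m/n]*n e h)) (ℕ.m≤n+m (f * h) (e ℕ.% h))
  base : suc e ≤ h * 2 ^ f
  base = begin
    suc e                 ≡⟨ cong suc (m≡m%n+[m/n]*n e h) ⟩
    suc (e ℕ.% h) + f * h   ≤⟨ ℕ.+-monoˡ-≤ (f * h) (m%n<n e h) ⟩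
    suc f * h             ≤⟨ ℕ.*-monoˡ-≤ h (n<2^n f) ⟩
    2 ^ f * h             ≡⟨ ℕ.*-comm (2 ^ f) h ⟩
    h * 2 ^ f             ∎

-- One step of a sieve in which `j` runs through all integers; the last component records that a `j`
-- which is not prime takes nothing out.
extract-factor : ∀ j {ps} → All Prime ps → All (j ≤_) ps →
  ∃[ e ] ∃[ qs ] product ps ≡ j ^ e * product qs × All Prime qs × All (suc j ≤_) qs × (e ≡ 0 ⊎ Prime j)
extract-factor j [] [] = 0 , [] , refl , [] , [] , inj₁ refl
extract-factor j {p ∷ ps} (pp ∷ pps) (j≤p ∷ j≤ps) with extract-factor j pps j≤ps | j ≟ p
... | e , qs , eq , pqs , j<qs , _ | yes refl =
  suc e , qs , trans (cong (j *_) eq) (sym (ℕ.*-assoc j (j ^ e) (product qs))) , pqs , j<qs , inj₂ pp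
... | e , qs , eq , pqs , j<qs , small | no j≢p =
  e , p ∷ qs , trans (cong (p *_) eq) (identity p (j ^ e) (product qs)) , pp ∷ pqs , ℕ.≤∧≢⇒< j≤p j≢p ∷ j<qs , small
  where
  identity : ∀ p a q → p * (a * q) ≡ a * (p * q)
  identity = ℕSolver.solve-∀

module _ (h : ℕ) .{{_ : NonZero h}} where

  -- Primes p ≥ 2 ^ h cost nothing, since (e + 1) ^ h ≤ 2 ^ (e h) ≤ p ^ e.
  divisorBound-large-primes : ∀ {ps} → All Prime ps → All (2 ^ h ≤_) ps →
    ∃[ t ] DivisorBound (product ps) t × t ^ h ≤ product ps
  divisorBound-large-primes [] [] = 1 , (1 ∷ [] , ℕ.≤-refl , λ a a∣1 → here (∣1⇒≡1 a∣1)) , ℕ.≤-reflexive (ℕ.^-zeroˡ h)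
  divisorBound-large-primes {p ∷ ps} (pp ∷ pps) (large ∷ larges) with divisorBound-large-primes pps larges
  ... | t , bound , t^h≤ = 2 * t ,
    subst (λ n → DivisorBound (n * product ps) (2 * t)) (ℕ.*-identityʳ p) (divisorBound-prime-power pp 1 bound) ,
    subst (_≤ p * product ps) (sym (^-distribʳ-* h 2 t)) (ℕ.*-mono-≤ large t^h≤)

  -- Here `d` counts the integers from `j` up to 2^h. Each of them costs at most a factor h^h by
  -- `suc^≤2^`, and from 2^h onwards nothing more is lost.
  divisorBound-primes : ∀ d j → j + d ≡ 2 ^ h → ∀ {ps} → All Prime ps → All (j ≤_) ps →
    ∃[ t ] DivisorBound (product ps) t × t ^ h ≤ (h ^ h) ^ d * product ps
  divisorBound-primes zero j eq {ps} pps j≤ps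
    with divisorBound-large-primes pps (subst (λ i → All (i ≤_) ps) (trans (sym (ℕ.+-identityʳ j)) eq) j≤ps)
  ... | t , bound , t^h≤ = t , bound , ℕ.≤-trans t^h≤ (ℕ.m≤m+n _ 0)
  divisorBound-primes (suc d) j eq {ps} pps j≤ps with extract-factor j pps j≤ps
  ... | e , qs , factored , pqs , j<qs , small with divisorBound-primes d (suc j) (trans (sym (ℕ.+-suc j d)) eq) pqs j<qs
  ...   | t , bound , t^h≤ with small
  ...     | inj₁ refl = t , subst (λ n → DivisorBound n t) (sym ps≡qs) bound , (begin
      t ^ h                             ≤⟨ t^h≤ ⟩
      (h ^ h) ^ d * product qs          ≤⟨ ℕ.*-monoˡ-≤ (product qs) (ℕ.m≤n*m ((h ^ h) ^ d) (h ^ h) {{ℕ.m^n≢0 h h}}) ⟩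
      (h ^ h) ^ suc d * product qs      ≡⟨ cong ((h ^ h) ^ suc d *_) ps≡qs ⟨
      (h ^ h) ^ suc d * product ps      ∎)
    where
    open ≤-Reasoning
    ps≡qs : product ps ≡ product qs
    ps≡qs = trans factored (ℕ.+-identityʳ (product qs))
  ...     | inj₂ pj = suc e * t , subst (λ n → DivisorBound n (suc e * t)) (sym factored) (divisorBound-prime-power pj e bound) , (begin
      (suc e * t) ^ h                                   ≡⟨ ^-distribʳ-* h (suc e) t ⟩
      suc e ^ h * t ^ h                                 ≤⟨ ℕ.*-mono-≤ (suc^≤2^ h e) t^h≤ ⟩
      h ^ h * 2 ^ e * ((h ^ h) ^ d * product qs)        ≤⟨ ℕ.*-monoˡ-≤ _ (ℕ.*-monoʳ-≤ (h ^ h) (ℕ.^-monoˡ-≤ e 2≤j)) ⟩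
      h ^ h * j ^ e * ((h ^ h) ^ d * product qs)        ≡⟨ identity (h ^ h) (j ^ e) ((h ^ h) ^ d) (product qs) ⟩
      (h ^ h) ^ suc d * (j ^ e * product qs)            ≡⟨ cong ((h ^ h) ^ suc d *_) factored ⟨
      (h ^ h) ^ suc d * product ps                      ∎)
    where
    open ≤-Reasoning
    2≤j : 2 ≤ j
    2≤j = nonTrivial⇒n>1 j {{prime⇒nonTrivial pj}}
    identity : ∀ k a b q → k * a * (b * q) ≡ k * b * (a * q)
    identity = ℕSolver.solve-∀

divisorBound-small : ∀ h .{{_ : NonZero h}} → ∃[ C ] (∀ n → 1 ≤ n → ∃[ t ] DivisorBound n t × t ^ h ≤ C * n)
divisorBound-small h = (h ^ h) ^ (2 ^ h) , bound
  where
  bound : ∀ n → 1 ≤ n → ∃[ t ] DivisorBound n t × t ^ h ≤ (h ^ h) ^ (2 ^ h) * n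
  bound n@(suc _) _ = subst (λ n → ∃[ t ] DivisorBound n t × t ^ h ≤ (h ^ h) ^ (2 ^ h) * n) (sym isFactorisation)
    (divisorBound-primes h (2 ^ h) 0 refl factorsPrime (zeros factors))
    where
    open PrimeFactorisation (factorise n)
    zeros : ∀ ps → All (0 ≤_) ps
    zeros []       = []
    zeros (p ∷ ps) = z≤n ∷ zeros ps

m≤m^n : ∀ m n .{{_ : NonZero n}} → m ≤ m ^ n
m≤m^n zero          n       = z≤n
m≤m^n (suc m) (suc n) = ℕ.m≤m*n (suc m) (suc m ^ n) {{ℕ.m^n≢0 (suc m) n}}

-- The integer part of the `h`-th root of `X`; the search can start at `X` because t ≤ t^h.
root : ∀ h .{{_ : NonZero h}} X → ∃[ δ ] δ ^ h ≤ X × (∀ t → t ^ h ≤ X → t ≤ δ)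
root h@(suc _) X with search X
  where
  search : ∀ b → ∃[ δ ] δ ^ h ≤ X × (∀ t → t ≤ b → t ^ h ≤ X → t ≤ δ)
  search zero    = 0 , z≤n , λ t t≤0 _ → t≤0
  search (suc b) with suc b ^ h ≤? X
  ... | yes fits = suc b , fits , λ t t≤ _ → t≤
  ... | no ¬fits with search b
  ...   | δ , δ^h≤ , largest = δ , δ^h≤ , λ t t≤ t^h≤ → largest t
            (ℕ.≤-pred (ℕ.≤∧≢⇒< t≤ λ t≡ → ¬fits (subst (λ t → t ^ h ≤ X) t≡ t^h≤))) t^h≤
... | δ , δ^h≤ , largest = δ , δ^h≤ , λ t t^h≤ → largest t (ℕ.≤-trans (m≤m^n t h) t^h≤) t^h≤

-- A single `δ` serves all n ≤ B, as counting needs: it is the root of the largest bound that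
-- occurs.
divisorBound : ∀ h .{{_ : NonZero h}} → ∃[ C ] (∀ B → 1 ≤ B → ∃[ δ ] 1 ≤ δ × δ ^ h ≤ C * B ×
               (∀ n → 1 ≤ n → n ≤ B → DivisorBound n δ))
divisorBound h with divisorBound-small h
-- The constant is enlarged to be positive, so that 1 is admissible in the root and `δ` is at least
-- 1.
... | C , bound = suc C , uniform
  where
  uniform : ∀ B → 1 ≤ B → ∃[ δ ] 1 ≤ δ × δ ^ h ≤ suc C * B × (∀ n → 1 ≤ n → n ≤ B → DivisorBound n δ)
  uniform B 1≤B with root h (suc C * B)
  ... | δ , δ^h≤ , largest = δ , largest 1 1^h≤ , δ^h≤ , λ n 1≤n n≤B →
        let t , divs , t^h≤ = bound n 1≤n in
        atMost-≤ (largest t (ℕ.≤-trans t^h≤ (ℕ.*-mono-≤ (ℕ.n≤1+n C) n≤B))) divs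
    where
    1^h≤ : 1 ^ h ≤ suc C * B
    1^h≤ = subst (_≤ suc C * B) (sym (ℕ.^-zeroˡ h)) (ℕ.≤-trans 1≤B (ℕ.m≤n*m B (suc C)))

-- Splitting off the new parts of the columns

∏ : ∀ {r} → (Fin r → ℕ) → ℕ
∏ {zero}  f = 1
∏ {suc r} f = f zero * ∏ (f ∘ suc)

∣-∏ : ∀ {r} (f : Fin r → ℕ) i → f i ∣ ∏ f
∣-∏ f zero    = m∣m*n _
∣-∏ f (suc i) = ∣n⇒∣m*n (f zero) (∣-∏ (f ∘ suc) i)

∏-mono-∣ : ∀ {r} {f g : Fin r → ℕ} → (∀ i → f i ∣ g i) → ∏ f ∣ ∏ g
∏-mono-∣ {zero}  f∣g = ∣-refl
∏-mono-∣ {suc r} f∣g = *-pres-∣ (f∣g zero) (∏-mono-∣ (f∣g ∘ suc))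

∏-const : ∀ r F → ∏ {r} (λ _ → F) ≡ F ^ r
∏-const zero    F = refl
∏-const (suc r) F = cong (F *_) (∏-const r F)

∏-* : ∀ {r} (f g : Fin r → ℕ) → ∏ (λ i → f i * g i) ≡ ∏ f * ∏ g
∏-* {zero}  f g = refl
∏-* {suc r} f g = trans (cong (f zero * g zero *_) (∏-* (f ∘ suc) (g ∘ suc))) (identity (f zero) (g zero) _ _)
  where
  identity : ∀ a b c d → a * b * (c * d) ≡ a * c * (b * d)
  identity = ℕSolver.solve-∀

^≤∏ : ∀ {r} (f : Fin r → ℕ) m → (∀ i → m ≤ f i) → m ^ r ≤ ∏ f
^≤∏ {zero}  f m m≤ = ℕ.≤-refl
^≤∏ {suc r} f m m≤ = ℕ.*-mono-≤ (m≤ zero) (^≤∏ (f ∘ suc) m (m≤ ∘ suc))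

argmin : ∀ {r} (f : Fin (suc r) → ℕ) → ∃[ m ] (∀ i → f m ≤ f i)
argmin {zero} f = zero , λ { zero → ℕ.≤-refl }
argmin {suc r} f with argmin (f ∘ suc)
... | m , least with ℕ.≤-total (f zero) (f (suc m))
...   | inj₁ ≤m = zero , λ { zero → ℕ.≤-refl ; (suc i) → ℕ.≤-trans ≤m (least i) }
...   | inj₂ m≤ = suc m , λ { zero → m≤ ; (suc i) → least i }

∏-coprime-∣ : ∀ {r} {w : Fin r → ℕ} {X} → (∀ i j → i ≢ j → Coprime (w i) (w j)) → (∀ i → w i ∣ X) → ∏ w ∣ X
∏-coprime-∣ {zero} {X = X} _ _ = 1∣ X
∏-coprime-∣ {suc r} {w} coprime w∣X with w∣X zero
... | divides Y refl = subst (_∣ Y * w zero) (ℕ.*-comm (∏ (w ∘ suc)) (w zero))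
  (*-monoˡ-∣ (w zero) (∏-coprime-∣ (λ i j i≢j → coprime (suc i) (suc j) (i≢j ∘ Fin.suc-injective))
    (λ i → coprime-divisor (coprime (suc i) zero λ ()) (subst (w (suc i) ∣_) (ℕ.*-comm Y (w zero)) (w∣X (suc i))))))

∣≥1 : ∀ {m n} → m ∣ n → 1 ≤ n → 1 ≤ m
∣≥1 {zero}  m∣n 1≤n = ⊥-elim (ℕ.<⇒≢ 1≤n (sym (0∣⇒≡0 m∣n)))
∣≥1 {suc m} _   _   = s≤s z≤n

∣≥1⇒≤ : ∀ {m n} → m ∣ n → 1 ≤ n → m ≤ n
∣≥1⇒≤ m∣n 1≤n = ∣⇒≤ {{>-nonZero 1≤n}} m∣n

-- Each `w i` divides the quotient of `L′` by `L`; by coprimality so does their product.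
*-∏-coprime-∣ : ∀ {r L L′} {w : Fin r → ℕ} → 1 ≤ L → L ∣ L′ → (∀ i j → i ≢ j → Coprime (w i) (w j)) →
                (∀ i → w i * L ∣ L′) → L * ∏ w ∣ L′
*-∏-coprime-∣ {L = L} {w = w} 1≤L (divides Q refl) coprime wL∣L′ = subst (L * ∏ w ∣_) (ℕ.*-comm L Q)
  (*-monoʳ-∣ L (∏-coprime-∣ coprime (λ i → *-cancelʳ-∣ L {{>-nonZero 1≤L}} (wL∣L′ i))))

opaque
  gcd : ℕ → ℕ → ℕ
  gcd = GCD.gcd

  gcd[m,n]∣m : ∀ m n → gcd m n ∣ m
  gcd[m,n]∣m = GCD.gcd[m,n]∣m

  gcd[m,n]∣n : ∀ m n → gcd m n ∣ n
  gcd[m,n]∣n = GCD.gcd[m,n]∣n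

  gcd-greatest : ∀ {m n d} → d ∣ m → d ∣ n → d ∣ gcd m n
  gcd-greatest = GCD.gcd-greatest

opaque
  -- Here `g` is the growth lcm(L, S a) / L. Since `S` divides `L`, this lcm divides L a, so `g`
  -- divides `a`. Cancelling `g` from the divisibility of g L by S a = S h g shows that `h` divides
  -- `L`.
  new-part : ∀ {L L′ S a} → 1 ≤ L′ → 1 ≤ a → L ∣ L′ → S ∣ L → S * a ∣ L′ →
             ∃[ g ] ∃[ h ] a ≡ g * h × (h ∣ L) × (g * L ∣ L′)
  new-part {L} {L′} {S} {a} 1≤L′ 1≤a L∣L′ S∣L Sa∣L′
    with m∣lcm[m,n] L (S * a) | lcm-least L∣L′ Sa∣L′ | lcm-least (m∣m*n {L} a) (*-monoˡ-∣ a S∣L) | n∣lcm[m,n] L (S * a)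
  ... | divides g lcm≡gL | lcm∣L′ | lcm∣La | Sa∣lcm
    with *-cancelˡ-∣ L {{>-nonZero (∣≥1 L∣L′ 1≤L′)}} (subst (_∣ L * a) (trans lcm≡gL (ℕ.*-comm g L)) lcm∣La)
  ... | divides h a≡hg = g , h , trans a≡hg (ℕ.*-comm h g) , m*n∣⇒n∣ S h Sh∣L , subst (_∣ L′) lcm≡gL lcm∣L′
    where
    identity : ∀ S h g → S * (h * g) ≡ g * (S * h)
    identity = ℕSolver.solve-∀
    g≥1 : 1 ≤ g
    g≥1 = ∣≥1 (divides h a≡hg) 1≤a
    Sh∣L : S * h ∣ L
    Sh∣L = *-cancelˡ-∣ g {{>-nonZero g≥1}} (subst (_∣ g * L) (trans (cong (S *_) a≡hg) (identity S h g)) (subst (S * a ∣_) lcm≡gL Sa∣lcm))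

-- The column entry factors as w d h: `h` is already present in `L`, `g` is new, and `d` is the
-- share of `g` in common with `D`, removed so that the `w` of different rows become coprime.
record Splitting (D L L′ a : ℕ) : Set where
  field
    g h w d  : ℕ
    a≡g*h    : a ≡ g * h
    h∣L      : h ∣ L
    g*L∣L′   : g * L ∣ L′
    g≡w*d    : g ≡ w * d
    d≡gcd    : d ≡ gcd g D

opaque
  split : ∀ {D L L′ S a} → 1 ≤ L′ → 1 ≤ a → L ∣ L′ → S ∣ L → S * a ∣ L′ → Splitting D L L′ a
  split {D} 1≤L′ 1≤a L∣L′ S∣L Sa∣L′ with new-part 1≤L′ 1≤a L∣L′ S∣L Sa∣L′
  ... | g , h , a≡gh , h∣L , gL∣L′ with gcd[m,n]∣m g D
  ...   | divides w g≡wc = record { g = g ; h = h ; w = w ; d = gcd g D ; a≡g*h = a≡gh ; h∣L = h∣L ; g*L∣L′ = gL∣L′ ; g≡w*d = g≡wc ; d≡gcd = refl }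

module _ {D L L′ a a′} (1≤a : 1 ≤ a) (s : Splitting D L L′ a) (s′ : Splitting D L L′ a′)
         (common : ∀ x → x ∣ a → x ∣ a′ → x ∣ D) where
  private
    module s = Splitting s
    module s′ = Splitting s′

  -- The common factor e of the parts g divides D, so it is contained in each d; a common factor x of the
  -- parts w = g / d would make e x a common factor of the parts g.
  splitting-coprime : Coprime s.w s′.w
  splitting-coprime {x} (x∣w , x∣w′) = ∣1⇒≡1 (*-cancelʳ-∣ e {{>-nonZero e≥1}} (subst (x * e ∣_) (sym (ℕ.*-identityˡ e)) xe∣e))
    where
    e = gcd s.g s′.g
    e∣g = gcd[m,n]∣m s.g s′.g
    e∣g′ = gcd[m,n]∣n s.g s′.g
    g∣a : s.g ∣ a
    g∣a = subst (s.g ∣_) (sym s.a≡g*h) (m∣m*n s.h)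
    g∣a′ : s′.g ∣ a′
    g∣a′ = subst (s′.g ∣_) (sym s′.a≡g*h) (m∣m*n s′.h)
    e≥1 : 1 ≤ e
    e≥1 = ∣≥1 (∣-trans e∣g g∣a) 1≤a
    e∣D : e ∣ D
    e∣D = common e (∣-trans e∣g g∣a) (∣-trans e∣g′ g∣a′)
    xe∣g : x * e ∣ s.g
    xe∣g = subst (x * e ∣_) (sym s.g≡w*d) (*-pres-∣ x∣w (subst (e ∣_) (sym s.d≡gcd) (gcd-greatest e∣g e∣D)))
    xe∣g′ : x * e ∣ s′.g
    xe∣g′ = subst (x * e ∣_) (sym s′.g≡w*d) (*-pres-∣ x∣w′ (subst (e ∣_) (sym s′.d≡gcd) (gcd-greatest e∣g′ e∣D)))
    xe∣e : x * e ∣ e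
    xe∣e = gcd-greatest xe∣g xe∣g′

module Decoding {C : Set} {r : ℕ} (a : Fin r → C → ℕ) (D B : ℕ) where

  extend : (Fin r → ℕ) → C → Fin r → ℕ
  extend S c j = S j * a j c

  -- Row m of the columns cs can be recovered, one column at a time, from divisors of W and of numbers
  -- determined by the previous columns; S holds the products of the rows over the previous columns.
  Decodable : Fin r → ℕ → (Fin r → ℕ) → List C → Set
  Decodable m W S []       = ⊤
  Decodable m W S (c ∷ cs) =
    ((1 ≤ ∏ S * D × ∏ S * D ≤ B) × (∃[ w ] w ∣ W × (∃[ t ] t ∣ ∏ S * D × a m c ≡ w * t))) × Decodable m W (extend S c) cs

  decodable-mono : ∀ {m W W′} S cs → W ∣ W′ → Decodable m W S cs → Decodable m W′ S cs
  decodable-mono S []       W∣W′ _ = tt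
  decodable-mono S (c ∷ cs) W∣W′ ((range , w , w∣W , rest) , dec) =
    (range , w , ∣-trans w∣W W∣W′ , rest) , decodable-mono (extend S c) cs W∣W′ dec

  module _ (F : ℕ) (1≤F : 1 ≤ F) (1≤D : 1 ≤ D) (bounded : F ^ r * D ≤ B)
           (common : ∀ i j → i ≢ j → ∀ c x → x ∣ a i c → x ∣ a j c → x ∣ D) where

    -- The number gcd(F, ∏ S) is a multiple of every `S j` that divides both `F` and the known
    -- product ∏ S. In each column it grows at least by the product of the new parts `w`, and the
    -- growth over all columns is confined by `F`; hence the bound on ∏ W.
    decode : ∀ S cs → (∀ j → S j * product (map (a j) cs) ∣ F) →
             ∃[ W ] gcd F (∏ S) * ∏ W ∣ F × (∀ m → Decodable m (W m) S cs)
    decode S [] _ = (λ _ → 1) , subst (_∣ F) (sym product≡) (gcd[m,n]∣m F (∏ S)) , λ _ → tt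
      where
      product≡ : gcd F (∏ S) * ∏ {r} (λ _ → 1) ≡ gcd F (∏ S)
      product≡ = trans (cong (gcd F (∏ S) *_) (trans (∏-const r 1) (ℕ.^-zeroˡ r))) (ℕ.*-identityʳ _)
    decode S (c ∷ cs) S∏∣F with decode (extend S c) cs (λ j → subst (_∣ F) (sym (ℕ.*-assoc (S j) (a j c) _)) (S∏∣F j))
    ... | W′ , L′∏∣F , dec = W , L∏W∣F , decs
      where
      S′ = extend S c
      L  = gcd F (∏ S)
      L′ = gcd F (∏ S′)
      S′∣F : ∀ j → S′ j ∣ F
      S′∣F j = m*n∣⇒m∣ (S′ j) (product (map (a j) cs)) (subst (_∣ F) (sym (ℕ.*-assoc (S j) (a j c) _)) (S∏∣F j))
      S∣F : ∀ j → S j ∣ F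
      S∣F j = m*n∣⇒m∣ (S j) (a j c) (S′∣F j)
      L∣L′ : L ∣ L′
      L∣L′ = gcd-greatest (gcd[m,n]∣m F (∏ S)) (∣-trans (gcd[m,n]∣n F (∏ S)) (∏-mono-∣ (λ j → m∣m*n (a j c))))
      1≤L′ : 1 ≤ L′
      1≤L′ = ∣≥1 (gcd[m,n]∣m F (∏ S′)) 1≤F
      1≤a : ∀ j → 1 ≤ a j c
      1≤a j = ∣≥1 (m*n∣⇒n∣ (S j) (a j c) (S′∣F j)) 1≤F
      splitting : ∀ j → Splitting D L L′ (a j c)
      splitting j = split 1≤L′ (1≤a j) L∣L′ (gcd-greatest (S∣F j) (∣-∏ S j)) (gcd-greatest (S′∣F j) (∣-∏ S′ j))
      open module sp (j : Fin r) = Splitting (splitting j)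
      W : Fin r → ℕ
      W j = w j * W′ j
      1≤L : 1 ≤ L
      1≤L = ∣≥1 L∣L′ 1≤L′
      -- A common divisor of two entries in this column divides `D`, so the parts `w` are pairwise
      -- coprime and their separate contributions to the growth multiply.
      L∏w∣L′ : L * ∏ w ∣ L′
      L∏w∣L′ = *-∏-coprime-∣ 1≤L L∣L′
        (λ i j i≢j → splitting-coprime (1≤a i) (splitting i) (splitting j) (common i j i≢j c))
        (λ j → ∣-trans (*-monoˡ-∣ L (subst (w j ∣_) (sym (g≡w*d j)) (m∣m*n _))) (g*L∣L′ j))
      L∏W∣F : L * ∏ W ∣ F
      L∏W∣F = ∣-trans (subst (_∣ L′ * ∏ W′) (trans (ℕ.*-assoc L (∏ w) (∏ W′)) (cong (L *_) (sym (∏-* w W′)))) (*-monoˡ-∣ (∏ W′) L∏w∣L′)) L′∏∣F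
      ∏S∣F^r : ∏ S ∣ F ^ r
      ∏S∣F^r = subst (∏ S ∣_) (∏-const r F) (∏-mono-∣ S∣F)
      1≤F^r : 1 ≤ F ^ r
      1≤F^r = ℕ.m^n>0 F {{>-nonZero 1≤F}} r
      decs : ∀ m → Decodable m (W m) S (c ∷ cs)
      decs m = ((ℕ.*-mono-≤ (∣≥1 ∏S∣F^r 1≤F^r) 1≤D , ℕ.≤-trans (ℕ.*-monoˡ-≤ D (∣≥1⇒≤ ∏S∣F^r 1≤F^r)) bounded) ,
          -- The cofactor is t = h d, where `h` divides `L` and thus ∏ S, and d divides `D`.
          w m , m∣m*n (W′ m) , h m * c′ , *-pres-∣ (∣-trans (h∣L m) (gcd[m,n]∣n F (∏ S))) c∣D ,
          trans (a≡g*h m) (trans (cong (_* h m) (g≡w*d m)) (identity (w m) c′ (h m)))) ,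
        decodable-mono S′ cs (n∣m*n (w m)) (dec m)
        where
        c′ = Splitting.d (splitting m)
        c∣D : c′ ∣ D
        c∣D = subst (_∣ D) (sym (d≡gcd m)) (gcd[m,n]∣n (g m) D)
        identity : ∀ w c h → w * c * h ≡ w * (h * c)
        identity = ℕSolver.solve-∀

-- Non-diagonal solutions in a box

abs-shiftProduct : ∀ t cs → ∣ shiftProduct t cs ∣ ≡ product (map (λ c → ∣ t ⊕ c ∣) cs)
abs-shiftProduct t []       = refl
abs-shiftProduct t (c ∷ cs) = trans (ℤ.∣i*j∣≡∣i∣*∣j∣ (t ⊕ c) _) (cong (∣ t ⊕ c ∣ *_) (abs-shiftProduct t cs))

shiftProduct-++ : ∀ t xs ys → shiftProduct t (xs ++ ys) ≡ shiftProduct t xs ⊛ shiftProduct t ys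
shiftProduct-++ t []       ys = sym (ℤ.*-identityˡ _)
shiftProduct-++ t (x ∷ xs) ys = trans (cong ((t ⊕ x) ⊛_) (shiftProduct-++ t xs ys)) (sym (ℤ.*-assoc (t ⊕ x) _ _))

∣-shiftProduct : ∀ t {y ys} → y ∈ ys → ∣ t ⊕ y ∣ ∣ ∣ shiftProduct t ys ∣
∣-shiftProduct t {ys = y ∷ ys} (here refl) = subst (∣ t ⊕ y ∣ ∣_) (sym (ℤ.∣i*j∣≡∣i∣*∣j∣ (t ⊕ y) _)) (m∣m*n _)
∣-shiftProduct t {ys = x ∷ ys} (there y∈)    = subst (_ ∣_) (sym (ℤ.∣i*j∣≡∣i∣*∣j∣ (t ⊕ x) _)) (∣n⇒∣m*n ∣ t ⊕ x ∣ (∣-shiftProduct t y∈))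

Within : ℕ → ℤ → Set
Within N z = ∣ z ∣ ≤ N

shiftProduct-≤ : ∀ {N t} → Within N t → ∀ {cs} → All (Within N) cs → ∣ shiftProduct t cs ∣ ≤ (N + N) ^ length cs
shiftProduct-≤ t≤ []                     = ℕ.≤-refl
shiftProduct-≤ {N} {t} t≤ {c ∷ cs} (c≤ ∷ cs≤) = subst (_≤ (N + N) ^ suc (length cs)) (sym (ℤ.∣i*j∣≡∣i∣*∣j∣ (t ⊕ c) _))
  (ℕ.*-mono-≤ (ℕ.≤-trans (ℤ.∣i+j∣≤∣i∣+∣j∣ t c) (ℕ.+-mono-≤ t≤ c≤)) (shiftProduct-≤ t≤ cs≤))

-- The absolute value of the Vandermonde product: one number, divisible by the difference of any two
-- rows, and positive exactly when the entries are distinct.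
discriminant : ∀ {r} → Vec ℤ r → ℕ
discriminant []ᵛ       = 1
discriminant (x ∷ᵛ xs) = ∣ shiftProduct x (map ⊖_ (toList xs)) ∣ * discriminant xs

difference∣discriminant : ∀ {r} (zs : Vec ℤ r) i j → i ≢ j → ∣ lookup zs i ℤ.- lookup zs j ∣ ∣ discriminant zs
difference∣discriminant (x ∷ᵛ xs) zero    zero    i≢j = ⊥-elim (i≢j refl)
difference∣discriminant (x ∷ᵛ xs) zero    (suc j) i≢j =
  ∣m⇒∣m*n {m = ∣ shiftProduct x (map ⊖_ (toList xs)) ∣} (discriminant xs) (∣-shiftProduct x (∈-map⁺ ⊖_ (∈-toList⁺ (∈-lookup j xs))))
difference∣discriminant (x ∷ᵛ xs) (suc i) zero    i≢j =
  subst (_∣ discriminant (x ∷ᵛ xs)) (ℤ.∣i-j∣≡∣j-i∣ x (lookup xs i)) (difference∣discriminant (x ∷ᵛ xs) zero (suc i) λ ())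
difference∣discriminant (x ∷ᵛ xs) (suc i) (suc j) i≢j =
  ∣n⇒∣m*n ∣ shiftProduct x (map ⊖_ (toList xs)) ∣ (difference∣discriminant xs i j (i≢j ∘ cong suc))

discriminant-≤ : ∀ {N r} (zs : Vec ℤ r) → 1 ≤ N → All (Within N) (toList zs) → discriminant zs ≤ (N + N) ^ (r * r)
discriminant-≤ []ᵛ _ _ = ℕ.≤-refl
discriminant-≤ {N} {suc r} (z ∷ᵛ zs) 1≤N (z≤ ∷ zs≤) = begin
  ∣ shiftProduct z (map ⊖_ (toList zs)) ∣ * discriminant zs
    ≤⟨ ℕ.*-mono-≤ (shiftProduct-≤ z≤ (All.map⁺ (All.map (λ {y} → subst (_≤ N) (sym (ℤ.∣-i∣≡∣i∣ y))) zs≤))) (discriminant-≤ zs 1≤N zs≤) ⟩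
  X ^ length (map ⊖_ (toList zs)) * X ^ (r * r)
    ≡⟨ cong (λ l → X ^ l * X ^ (r * r)) (trans (List.length-map ⊖_ (toList zs)) (Vec.length-toList zs)) ⟩
  X ^ r * X ^ (r * r)
    ≡⟨ ℕ.^-distribˡ-+-* X r (r * r) ⟨
  X ^ (r + r * r)
    ≤⟨ ℕ.^-monoʳ-≤ X {{>-nonZero (ℕ.≤-trans 1≤N (ℕ.m≤m+n N N))}} (subst (r + r * r ≤_) (identity r) (ℕ.m≤n+m (r + r * r) (suc r))) ⟩
  X ^ (suc r * suc r) ∎
  where
  open ≤-Reasoning
  X = N + N
  identity : ∀ r → suc r + (r + r * r) ≡ suc r * suc r
  identity = ℕSolver.solve-∀

open DecMembership ℤ._≟_ using (_∈?_)

-- Greedy selection: a further entry is chosen outside the values selected so far, until there are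
-- `r` of them or none is left.
distinct-entries : ∀ {N} r zs → All (Within N) zs →
  (Σ[ ds ∈ Vec ℤ r ] ∃[ cs ] zs ↭ toList ds ++ cs × 1 ≤ discriminant ds) ⊎
  (Σ[ ds ∈ Vec ℤ r ] All (Within N) (toList ds) × All (_∈ toList ds) zs)
distinct-entries zero    zs zs≤ = inj₁ ([]ᵛ , zs , ↭-refl , ℕ.≤-refl)
distinct-entries (suc r) zs zs≤ with distinct-entries r zs zs≤
-- The entry 0 only pads the vector of values to length `r`.
... | inj₂ (ds , ds≤ , zs∈) = inj₂ (0ℤ ∷ᵛ ds , z≤n ∷ ds≤ , All.map there zs∈)
... | inj₁ (ds , cs , zs↭ , 1≤disc) with all? (_∈? toList ds) cs
...   | yes cs∈ = inj₂ (0ℤ ∷ᵛ ds , z≤n ∷ All.++⁻ˡ (toList ds) (Perm.All-resp-↭ zs↭ zs≤) ,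
          All.map there (Perm.All-resp-↭ (↭-sym zs↭) (All.++⁺ (All.tabulate (λ d∈ → d∈)) cs∈)))
...   | no ¬cs∈ with find (All.¬All⇒Any¬ (_∈? toList ds) cs ¬cs∈)
...     | c , c∈cs , c∉ds with ∈-∃++ c∈cs
...       | as , bs , refl = inj₁ (c ∷ᵛ ds , as ++ bs , moved , ℕ.*-mono-≤ (ℕ.n≢0⇒n>0 nonzero) 1≤disc)
  where
  moved : zs ↭ c ∷ toList ds ++ as ++ bs
  moved = ↭-trans zs↭ (↭-trans (Perm.++⁺ˡ (toList ds) (Perm.shift c as bs)) (Perm.shift c (toList ds) (as ++ bs)))
  nonzero : ∣ shiftProduct c (map ⊖_ (toList ds)) ∣ ≢ 0
  nonzero eq with shiftProduct-zero c (map ⊖_ (toList ds)) (ℤ.∣i∣≡0⇒i≡0 eq)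
  ... | _ , y∈ , c+y≡0 with ∈-map⁻ ⊖_ y∈
  ...   | d , d∈ , refl = c∉ds (subst (_∈ toList ds) (sym (ℤ.i-j≡0⇒i≡j c d c+y≡0)) d∈)

common-divisor : ∀ {r} (zs : Vec ℤ r) i j → i ≢ j → ∀ c x → x ∣ ∣ lookup zs i ⊕ c ∣ → x ∣ ∣ lookup zs j ⊕ c ∣ → x ∣ discriminant zs
common-divisor zs i j i≢j c x x∣i x∣j = ∣-trans
  (subst (λ z → x ∣ ∣ z ∣) (identity (lookup zs i) (lookup zs j) c)
    (Signed.∣⇒∣ᵤ (Signed.∣m∣n⇒∣m-n {+ x} {lookup zs i ⊕ c} {lookup zs j ⊕ c} (Signed.∣ᵤ⇒∣ x∣i) (Signed.∣ᵤ⇒∣ x∣j))))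
  (difference∣discriminant zs i j i≢j)
  where
  identity : ∀ a b c → (a ⊕ c) ℤ.- (b ⊕ c) ≡ a ℤ.- b
  identity a b c = trans (cong ((a ⊕ c) ⊕_) (ℤ.neg-distrib-+ b c)) (rest a b c)
    where
    rest : ∀ a b c → a ⊕ c ⊕ (⊖ b ⊕ ⊖ c) ≡ a ⊕ ⊖ b
    rest = ℤSolver.solve-∀

atMost-∈ : ∀ {A : Set} (xs : List A) → AtMost (_∈ xs) (length xs)
atMost-∈ xs = xs , ℕ.≤-refl , λ _ a∈ → a∈

atMost-lists : ∀ {A : Set} {P : A → Set} {b} n → AtMost P b → AtMost (λ xs → length xs ≡ n × All P xs) (b ^ n)
atMost-lists zero    bound = [ [] ] , ℕ.≤-refl , λ { [] _ → here refl }
atMost-lists (suc n) bound = atMost-⊆ (λ { (x ∷ xs) (len , px ∷ pxs) → x , px , xs , (ℕ.suc-injective len , pxs) , refl })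
  (atMost-bind bound λ x → atMost-image (x ∷_) (atMost-lists n bound))

atMost-vectors : ∀ {A : Set} {P : A → Set} {b} n → AtMost P b → AtMost (λ (xs : Vec A n) → All P (toList xs)) (b ^ n)
atMost-vectors zero    bound = [ []ᵛ ] , ℕ.≤-refl , λ { []ᵛ _ → here refl }
atMost-vectors (suc n) bound = atMost-⊆ (λ { (x ∷ᵛ xs) (px ∷ pxs) → x , px , xs , pxs , refl })
  (atMost-bind bound λ x → atMost-image (x ∷ᵛ_) (atMost-vectors n bound))

atMost-Fin : ∀ n → AtMost {Fin n} (λ _ → ⊤) n
atMost-Fin n = allFin n , ℕ.≤-reflexive (List.length-tabulate {n = n} (λ i → i)) , λ i _ → ∈-allFin i

atMost-abs : ∀ n → AtMost (λ z → ∣ z ∣ ≡ n) 2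
atMost-abs n = + n ∷ ⊖ (+ n) ∷ [] , ℕ.≤-refl , member
  where
  member : ∀ z → ∣ z ∣ ≡ n → z ∈ + n ∷ ⊖ (+ n) ∷ []
  member (+ _)      refl = here refl
  member -[1+ _ ]   refl = there (here refl)

atMost-within : ∀ N → AtMost (Within N) (suc N * 2)
atMost-within N = atMost-⊆ (λ z z≤ → ∣ z ∣ , z≤ , refl) (atMost-bind (atMost-≤-upTo N) atMost-abs)

atMost-shift : ∀ u n → AtMost (λ c → ∣ u ⊕ c ∣ ≡ n) 2
atMost-shift u n = atMost-⊆ (λ c eq → u ⊕ c , eq , identity u c) (atMost-image (λ z → z ⊕ ⊖ u) (atMost-abs n))
  where
  identity : ∀ u c → c ≡ u ⊕ c ⊕ ⊖ u
  identity = ℤSolver.solve-∀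

-- What the count retains of a non-diagonal solution; the nonvanishing of E replaces the condition
-- of not being a permutation.
record Nontrivial (k N : ℕ) (zs : List ℤ) : Set where
  field
    len     : length zs ≡ suc (suc (double k))
    within  : All (Within N) zs
    odd     : OddPowerSumsVanish k zs
    esym≢0  : esym (suc (double k)) zs ≢ 0ℤ

module Counting (k r′ q N T δ : ℕ) (r+q≡n : suc r′ + q ≡ suc (suc (double k))) (1≤N : 1 ≤ N) where

  r n X B : ℕ
  r = suc r′
  n = suc (suc (double k))
  X = N + N
  -- The two summands of the exponent bound F^r, by F ≤ X^n, and the discriminant.
  B = X ^ (n * r + r * r)

  entry : Vec ℤ r → Fin r → ℤ → ℕ
  entry zs j c = ∣ lookup zs j ⊕ c ∣

  -- The factors of row `j` that come from the other fixed entries; they start the partial products.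
  initial : Vec ℤ r → Fin r → ℕ
  initial zs j = ∣ shiftProduct (lookup zs j) (toList (removeAt zs j)) ∣

  module Code (zs : Vec ℤ r) = Decoding (entry zs) (discriminant zs) B

  -- The existentials follow the order of decoding and the shape produced by `atMost-bind`: fixed
  -- entries, row, `W`, columns. The last clause lets `z` be any word of length `n` in the decoded
  -- entries, which costs a factor n^n.
  Generic : List ℤ → Set
  Generic z = Σ[ zs ∈ Vec ℤ r ] All (Within N) (toList zs) × (∃[ m ] ⊤ × (∃[ W ] W ≤ T × (∃[ cs ]
    ((1 ≤ W × W ≤ B) × length cs ≡ q × Code.Decodable zs m W (initial zs) cs) ×
    (length cs ≡ q × length z ≡ n × All (_∈ toList zs ++ cs) z))))

  FewValues : List ℤ → Set
  FewValues z = Σ[ ds ∈ Vec ℤ r ] All (Within N) (toList ds) × length z ≡ n × All (_∈ toList ds) z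

  instance
    X≢0 : NonZero X
    X≢0 = >-nonZero (ℕ.≤-trans 1≤N (ℕ.m≤m+n N N))

  1≤X^ : ∀ e → 1 ≤ X ^ e
  1≤X^ e = ℕ.m^n>0 X e

  module _ (root-bound : ∀ W → W ^ r ≤ X ^ q → W ≤ T) (divisor-bound : ∀ m → 1 ≤ m → m ≤ B → DivisorBound m δ) where

    -- Each column costs `δ` choices for a divisor of `W`, `δ` for a divisor of `K`, and two signs;
    -- the decoded entry then determines the next partial products.
    columns : ∀ zs m W → 1 ≤ W → W ≤ B → ∀ S q →
              AtMost (λ cs → length cs ≡ q × Code.Decodable zs m W S cs) ((δ * (δ * 2)) ^ q)
    columns zs m W 1≤W W≤B S zero    = [ [] ] , ℕ.≤-refl , λ { [] _ → here refl }
    columns zs m W 1≤W W≤B S (suc q) = atMost-⊆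
      (λ { (c ∷ cs) (len , head , dec) → c , head , cs , (ℕ.suc-injective len , dec) , refl })
      (atMost-bind
        -- The divisor bound holds only in the range from 1 to `B`, a condition that `Decodable`
        -- carries along.
        (atMost-guard (1 ≤? K ×-dec K ≤? B) λ (1≤K , K≤B) →
          atMost-bind (divisor-bound W 1≤W W≤B) λ w → atMost-bind (divisor-bound K 1≤K K≤B) λ t →
          atMost-shift (lookup zs m) (w * t))
        (λ c → atMost-image (c ∷_) (columns zs m W 1≤W W≤B (Code.extend zs S c) q)))
      where
      K = ∏ S * discriminant zs

    atMost-generic : AtMost Generic ((suc N * 2) ^ r * (r * (suc T * ((δ * (δ * 2)) ^ q * n ^ n))))
    atMost-generic =
      atMost-bind (atMost-vectors r (atMost-within N)) λ zs →
      atMost-bind (atMost-Fin r) λ m →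
      atMost-bind (atMost-≤-upTo T) λ W →
      atMost-bind (atMost-guard (1 ≤? W ×-dec W ≤? B) λ (1≤W , W≤B) → columns zs m W 1≤W W≤B (initial zs) q) λ cs →
      atMost-guard (length cs ≟ q) λ len →
      atMost-lists n (atMost-≤ (ℕ.≤-reflexive (alphabet zs cs len)) (atMost-∈ (toList zs ++ cs)))
      where
      alphabet : ∀ (zs : Vec ℤ r) cs → length cs ≡ q → length (toList zs ++ cs) ≡ n
      alphabet zs cs len = trans (List.length-++ (toList zs)) (trans (cong₂ _+_ (Vec.length-toList zs) len) r+q≡n)

    atMost-fewValues : AtMost FewValues ((suc N * 2) ^ r * r ^ n)
    atMost-fewValues = atMost-bind (atMost-vectors r (atMost-within N)) λ ds →
      atMost-lists n (atMost-≤ (ℕ.≤-reflexive (Vec.length-toList ds)) (atMost-∈ (toList ds)))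

    module _ {z} (nontrivial : Nontrivial k N z) where
      open Nontrivial nontrivial

      module _ (zs : Vec ℤ r) (cs : List ℤ) (z↭ : z ↭ toList zs ++ cs) (1≤disc : 1 ≤ discriminant zs) where

        F : ℕ
        F = ∣ esym (suc (double k)) z ∣

        1≤F : 1 ≤ F
        1≤F = ℕ.n≢0⇒n>0 (esym≢0 ∘ ℤ.∣i∣≡0⇒i≡0)

        parts-within : All (Within N) (toList zs ++ cs)
        parts-within = Perm.All-resp-↭ z↭ within

        zs-within : All (Within N) (toList zs)
        zs-within = All.++⁻ˡ (toList zs) parts-within

        cs-within : All (Within N) cs
        cs-within = All.++⁻ʳ (toList zs) parts-within

        cs-length : length cs ≡ q
        cs-length = ℕ.+-cancelˡ-≡ r _ _ (trans (trans (cong (_+ length cs) (sym (Vec.length-toList zs)))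
          (trans (sym (List.length-++ (toList zs))) (trans (sym (Perm.↭-length z↭)) len))) (sym r+q≡n))

        others : Fin r → List ℤ
        others j = toList (removeAt zs j) ++ cs

        z↭row : ∀ j → z ↭ lookup zs j ∷ others j
        z↭row j = ↭-trans z↭ (Perm.++⁺ʳ cs (toList-removeAt zs j))

        row-value : ∀ j → ∣ shiftProduct (lookup zs j) (others j) ∣ ≡ F
        row-value j = cong ∣_∣ (trans
          (row-product k (lookup zs j) (others j)
            (ℕ.suc-injective (trans (sym (Perm.↭-length (z↭row j))) len))
            (λ i i<k → trans (sym (psum-↭ (suc (double i)) (z↭row j))) (odd i i<k)))
          (sym (esym-↭ (suc (double k)) (z↭row j))))

        row-factors : ∀ j → initial zs j * product (map (entry zs j) cs) ≡ F
        row-factors j = trans (cong (initial zs j *_) (sym (abs-shiftProduct (lookup zs j) cs)))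
          (trans (sym (ℤ.∣i*j∣≡∣i∣*∣j∣ (shiftProduct (lookup zs j) (toList (removeAt zs j))) _))
          (trans (cong ∣_∣ (sym (shiftProduct-++ (lookup zs j) (toList (removeAt zs j)) cs))) (row-value j)))

        F≤ : F ≤ X ^ n
        F≤ with Perm.All-resp-↭ (z↭row zero) within
        ... | z₀≤ ∷ others≤ = begin
          F                               ≡⟨ row-value zero ⟨
          ∣ shiftProduct (lookup zs zero) (others zero) ∣ ≤⟨ shiftProduct-≤ z₀≤ others≤ ⟩
          X ^ length (others zero)        ≤⟨ ℕ.^-monoʳ-≤ X (ℕ.≤-trans (ℕ.n≤1+n _) (ℕ.≤-reflexive (trans (sym (Perm.↭-length (z↭row zero))) len))) ⟩
          X ^ n                           ∎
          where open ≤-Reasoning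

        F^r*disc≤B : F ^ r * discriminant zs ≤ B
        F^r*disc≤B = begin
          F ^ r * discriminant zs            ≤⟨ ℕ.*-mono-≤ (ℕ.^-monoˡ-≤ r F≤) (discriminant-≤ zs 1≤N zs-within) ⟩
          (X ^ n) ^ r * X ^ (r * r)          ≡⟨ cong (_* X ^ (r * r)) (ℕ.^-*-assoc X n r) ⟩
          X ^ (n * r) * X ^ (r * r)          ≡⟨ ℕ.^-distribˡ-+-* X (n * r) (r * r) ⟨
          B                                  ∎
          where open ≤-Reasoning

        F≤B : F ≤ B
        F≤B = ℕ.≤-trans (m≤m^n F r) (ℕ.≤-trans (ℕ.m≤m*n (F ^ r) (discriminant zs) {{>-nonZero 1≤disc}}) F^r*disc≤B)

        generic : Generic z
        generic with Code.decode zs F 1≤F 1≤disc F^r*disc≤B (common-divisor zs) (initial zs) cs (λ j → ∣-reflexive (row-factors j))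
        ... | W , L∏W∣F , dec with argmin W
        ...   | m , least = zs , zs-within , m , tt , W m , root-bound (W m) (ℕ.≤-trans W^r≤∏ ∏W≤) , cs ,
            ((1≤W , ℕ.≤-trans (∣≥1⇒≤ Wm∣F 1≤F) F≤B) , cs-length , dec m) , cs-length , len , All.tabulate (Perm.∈-resp-↭ z↭)
          where
          L = gcd F (∏ (initial zs))
          P = product (map (entry zs zero) cs)
          S₀ = initial zs zero
          S₀∣F : S₀ ∣ F
          S₀∣F = subst (S₀ ∣_) (row-factors zero) (m∣m*n P)
          S₀*∏W∣F : S₀ * ∏ W ∣ F
          S₀*∏W∣F = ∣-trans (*-monoˡ-∣ (∏ W) (gcd-greatest S₀∣F (∣-∏ (initial zs) zero))) L∏W∣F
          1≤S₀ : 1 ≤ S₀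
          1≤S₀ = ∣≥1 S₀∣F 1≤F
          1≤P : 1 ≤ P
          1≤P = ∣≥1 (subst (P ∣_) (row-factors zero) (n∣m*n S₀)) 1≤F
          -- Cancelling the share `S₀` of the fixed entries from F = S₀ P leaves `q` factors of size
          -- at most 2N; `F` itself would give only the exponent 2k + 1.
          ∏W∣P : ∏ W ∣ P
          ∏W∣P = *-cancelˡ-∣ S₀ {{>-nonZero 1≤S₀}} (subst (S₀ * ∏ W ∣_) (sym (row-factors zero)) S₀*∏W∣F)
          P≤ : P ≤ X ^ q
          P≤ = subst (λ l → P ≤ X ^ l) cs-length (subst (_≤ X ^ length cs) (abs-shiftProduct (lookup zs zero) cs)
                 (shiftProduct-≤ (All.lookup zs-within (∈-toList⁺ (∈-lookup zero zs))) cs-within))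
          ∏W≤ : ∏ W ≤ X ^ q
          ∏W≤ = ℕ.≤-trans (∣≥1⇒≤ ∏W∣P 1≤P) P≤
          W^r≤∏ : W m ^ r ≤ ∏ W
          W^r≤∏ = ^≤∏ W (W m) least
          Wm∣F : W m ∣ F
          Wm∣F = ∣-trans (∣-∏ W m) (m*n∣⇒n∣ S₀ (∏ W) S₀*∏W∣F)
          1≤W : 1 ≤ W m
          1≤W = ∣≥1 Wm∣F 1≤F

      generic⊎fewValues : Generic z ⊎ FewValues z
      generic⊎fewValues with distinct-entries r z within
      ... | inj₁ (zs , cs , z↭ , 1≤disc) = inj₁ (generic zs cs z↭ 1≤disc)
      ... | inj₂ (ds , ds≤ , z∈)         = inj₂ (ds , ds≤ , len , z∈)

    atMost-nontrivial : AtMost (Nontrivial k N)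
      ((suc N * 2) ^ r * (r * (suc T * ((δ * (δ * 2)) ^ q * n ^ n))) + (suc N * 2) ^ r * r ^ n)
    atMost-nontrivial = atMost-⊆ (λ z → generic⊎fewValues) (atMost-⊎ atMost-generic atMost-fewValues)

-- From covers to the difference of the two counts

unique-⊆⇒length-≤ : ∀ {A : Set} {xs : List A} ys → Unique xs → (∀ {x} → x ∈ xs → x ∈ ys) → length xs ≤ length ys
unique-⊆⇒length-≤ {xs = []}     ys _             _  = z≤n
unique-⊆⇒length-≤ {xs = x ∷ xs} ys (x∉ ∷ unique) ⊆ys with ∈-∃++ (⊆ys (here refl))
... | as , bs , refl = subst (suc (length xs) ≤_) (sym (Perm.↭-length (Perm.shift x as bs)))
        (s≤s (unique-⊆⇒length-≤ (as ++ bs) unique rest))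
  where
  rest : ∀ {y} → y ∈ xs → y ∈ as ++ bs
  rest y∈ with ∈-++⁻ as (⊆ys (there y∈))
  ... | inj₁ y∈as            = ∈-++⁺ˡ y∈as
  ... | inj₂ (here refl)   = ⊥-elim (All.lookup x∉ y∈ refl)
  ... | inj₂ (there y∈bs)    = ∈-++⁺ʳ as y∈bs

atMost⇒length-≤ : ∀ {A : Set} {P : A → Set} {n xs} → AtMost P n → Unique xs → All P xs → length xs ≤ n
atMost⇒length-≤ (ys , len , mem) unique all = ℕ.≤-trans (unique-⊆⇒length-≤ ys unique (λ x∈ → mem _ (All.lookup all x∈))) len

-- The list collects the elements with `P` and without `Q`; an element with `Q` alone merely
-- enlarges the right side.
count-difference : ∀ {A : Set} {P Q : A → Set} {xs v l} → Unique xs → CountIs P xs v → CountIs Q xs l →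
  ∃[ ys ] v ≤ l + length ys × Unique ys × All (λ y → y ∈ xs × P y × ¬ Q y) ys
count-difference _ c-nil c-nil = [] , z≤n , [] , []
count-difference {xs = x ∷ xs} {l = l} (x∉ ∷ unique) cP cQ = extend cP cQ
  where
  weaken : ∀ {A : Set} {P Q : A → Set} {x : A} {xs ys} →
           All (λ y → y ∈ xs × P y × ¬ Q y) ys → All (λ y → y ∈ x ∷ xs × P y × ¬ Q y) ys
  weaken = All.map (λ (y∈ , rest) → there y∈ , rest)
  extend : ∀ {v l} → CountIs _ (x ∷ xs) v → CountIs _ (x ∷ xs) l →
           ∃[ ys ] v ≤ l + length ys × Unique ys × All (λ y → y ∈ x ∷ xs × _ × ¬ _) ys
  extend (c-yes _ cP) (c-yes _ cQ) with count-difference unique cP cQ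
  ... | ys , v≤ , u , all = ys , s≤s v≤ , u , weaken all
  extend (c-yes p cP) (c-no ¬q cQ) with count-difference unique cP cQ
  ... | ys , v≤ , u , all = x ∷ ys , ℕ.≤-trans (s≤s v≤) (ℕ.≤-reflexive (sym (ℕ.+-suc _ (length ys)))) ,
        All.map (λ (y∈ , _) → All.lookup x∉ y∈) all ∷ u , (here refl , p , ¬q) ∷ weaken all
  extend (c-no _ cP) (c-yes _ cQ) with count-difference unique cP cQ
  ... | ys , v≤ , u , all = ys , ℕ.m≤n⇒m≤1+n v≤ , u , weaken all
  extend (c-no _ cP) (c-no _ cQ) with count-difference unique cP cQ
  ... | ys , v≤ , u , all = ys , v≤ , u , weaken all

box-unique : ∀ N m → Unique (box N m)
box-unique N zero    = [] ∷ []
box-unique N (suc m) = Unique.concat⁺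
  (All.map⁺ (All.tabulate (λ _ → Unique.map⁺ Vec.∷-injectiveʳ (box-unique N m))))
  (AllPairs.map⁺ (AllPairs.map (λ a≢b {v} (v∈ , v∈′) → disjoint a≢b v∈ v∈′)
    (Unique.applyUpTo⁺₁ suc N (λ i<j _ eq → ℕ.<⇒≢ i<j (ℕ.suc-injective eq)))))
  where
  disjoint : ∀ {a b v} → a ≢ b → v ∈ map (a ∷ᵛ_) (box N m) → ¬ (v ∈ map (b ∷ᵛ_) (box N m))
  disjoint a≢b v∈ v∈′ with ∈-map⁻ _ v∈ | ∈-map⁻ _ v∈′
  ... | _ , _ , refl | _ , _ , eq = a≢b (Vec.∷-injectiveˡ eq)

box-entries : ∀ N m {v} → v ∈ box N m → All (λ a → 1 ≤ a × a ≤ N) (toList v)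
box-entries N zero {[]ᵛ} _ = []
box-entries N (suc m) v∈ with find (∈-concatMap⁻ (λ a → map (a ∷ᵛ_) (box N m)) {xs = applyUpTo suc N} v∈)
... | a , a∈ , v∈′ with ∈-applyUpTo⁻ suc a∈ | ∈-map⁻ (a ∷ᵛ_) v∈′
...   | i , i<N , refl | w , w∈ , refl = (s≤s z≤n , i<N) ∷ box-entries N m w∈

toList-++-injective : ∀ {A : Set} {m} (x x′ : Vec A m) {ys ys′} → toList x ++ ys ≡ toList x′ ++ ys′ → x ≡ x′ × ys ≡ ys′
toList-++-injective []ᵛ       []ᵛ         eq = refl , eq
toList-++-injective (a ∷ᵛ x) (a′ ∷ᵛ x′) eq with toList-++-injective x x′ (List.∷-injectiveʳ eq)
... | refl , ys≡ = cong (_∷ᵛ x) (List.∷-injectiveˡ eq) , ys≡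

abs-signed : ∀ xs ys → map ∣_∣ (signed xs ys) ≡ xs ++ ys
abs-signed xs ys = trans (List.map-++ ∣_∣ (map +_ xs) _) (cong₂ _++_
  (trans (sym (List.map-∘ xs)) (List.map-id xs))
  (trans (sym (List.map-∘ ys)) (trans (List.map-cong (λ y → ℤ.∣-i∣≡∣i∣ (+ y)) ys) (List.map-id ys))))

signedPair : ∀ {m} → Vec ℕ m × Vec ℕ m → List ℤ
signedPair (x , y) = signed (toList x) (toList y)

-- Absolute values undo the signs, and the fixed length `m` marks where the first tuple ends.
signedPair-injective : ∀ {m} {p p′ : Vec ℕ m × Vec ℕ m} → signedPair p ≡ signedPair p′ → p ≡ p′
signedPair-injective {p = x , y} {x′ , y′} eq
  with toList-++-injective x x′ (trans (sym (abs-signed (toList x) (toList y))) (trans (cong (map ∣_∣) eq) (abs-signed (toList x′) (toList y′))))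
... | x≡x′ , ys≡ = cong₂ _,_ x≡x′ (proj₁ (toList-++-injective y y′ (cong (_++ []) ys≡)))

signedPair-nontrivial : ∀ k N {p} → p ∈ pairs k N → OddSystem k p → ¬ IsPerm p → Nontrivial k N (signedPair p)
signedPair-nontrivial k N {x , y} p∈ odd ¬perm = record
  { len    = trans (signed-length {toList x} {toList y} lx ly) (cong suc (trans (ℕ.+-suc k k) (cong suc (sym (double≡+ k)))))
  ; within = All.++⁺ (All.map⁺ (All.map proj₂ (entries x x∈)))
               (All.map⁺ (All.map (λ {a} (_ , a≤N) → subst (_≤ N) (sym (ℤ.∣-i∣≡∣i∣ (+ a))) a≤N) (entries y y∈)))
  ; odd    = vanish
  ; esym≢0 = λ e≡0 → ¬perm (↭⇒IsPerm x y (odd-system+esym⇒↭ k (All.map proj₁ (entries x x∈)) lx ly vanish e≡0))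
  }
  where
  x∈ = proj₁ (∈-cartesianProduct⁻ (box N (suc k)) (box N (suc k)) p∈)
  y∈ = proj₂ (∈-cartesianProduct⁻ (box N (suc k)) (box N (suc k)) p∈)
  entries : ∀ v → v ∈ box N (suc k) → All (λ a → 1 ≤ a × a ≤ N) (toList v)
  entries v = box-entries N (suc k)
  lx = Vec.length-toList x
  ly = Vec.length-toList y
  vanish = OddSystem⇒vanish k x y odd

count-≤ : ∀ k N {n} → AtMost (Nontrivial k N) n → ∀ v l → VCount k N v → LCount k N l → v ∸ l ≤ n
count-≤ k N bound v l cV cL
  with count-difference (Unique.cartesianProduct⁺ (box-unique N (suc k)) (box-unique N (suc k))) cV cL
... | ps , v≤ , unique , all = ℕ.m≤n+o⇒m∸n≤o v l (ℕ.≤-trans v≤ (ℕ.+-monoʳ-≤ l (subst (_≤ _) (List.length-map signedPair ps)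
      (atMost⇒length-≤ bound (Unique.map⁺ signedPair-injective unique)
        (All.map⁺ (All.map (λ (p∈ , odd , ¬perm) → signedPair-nontrivial k N p∈ odd ¬perm) all))))))

-- Exponents

^-cancelʳ-≤ : ∀ m n o .{{_ : NonZero o}} → m ^ o ≤ n ^ o → m ≤ n
^-cancelʳ-≤ m n o m^o≤n^o = ℕ.≮⇒≥ λ n<m → ℕ.<⇒≱ (ℕ.^-monoˡ-< o n<m) m^o≤n^o

twice-^ : ∀ N e → (N + N) ^ e ≡ 2 ^ e * N ^ e
twice-^ N e = trans (cong (λ M → (N + M) ^ e) (sym (ℕ.+-identityʳ N))) (^-distribʳ-* e 2 N)

-- Separates a constant from the quantities that grow with `N`. As `T` and `δ` are at least 1, the
-- solutions with few values are absorbed by the main term.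
cover-size-≤ : ∀ {N T δ} r q n → 1 ≤ N → 1 ≤ T → 1 ≤ δ →
  (suc N * 2) ^ r * (r * (suc T * ((δ * (δ * 2)) ^ q * n ^ n))) + (suc N * 2) ^ r * r ^ n
    ≤ (4 ^ r * (2 * r * 2 ^ q * n ^ n + r ^ n)) * (N ^ r * T * (δ ^ q * δ ^ q))
cover-size-≤ {N} {T} {δ} r q n 1≤N 1≤T 1≤δ = begin
  (suc N * 2) ^ r * (r * (suc T * ((δ * (δ * 2)) ^ q * n ^ n))) + (suc N * 2) ^ r * r ^ n
    ≤⟨ ℕ.+-mono-≤
         (ℕ.*-mono-≤ base (ℕ.*-monoʳ-≤ r (ℕ.*-mono-≤ (ℕ.+-mono-≤ 1≤T (ℕ.≤-reflexive (sym (ℕ.+-identityʳ T)))) (ℕ.≤-reflexive (cong (_* n ^ n) expand)))))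
         (ℕ.*-mono-≤ base (ℕ.m≤m*n (r ^ n) (T * (P * P)) {{>-nonZero 1≤TPP}})) ⟩
  A * R * (r * (2 * T * (P * (P * Q) * Y))) + A * R * (Z * (T * (P * P)))
    ≡⟨ identity A R r T P Q Y Z ⟩
  (A * (2 * r * Q * Y + Z)) * (R * T * (P * P)) ∎
  where
  open ≤-Reasoning
  A = 4 ^ r
  R = N ^ r
  P = δ ^ q
  Q = 2 ^ q
  Y = n ^ n
  Z = r ^ n
  1≤TPP : 1 ≤ T * (P * P)
  1≤TPP = ℕ.*-mono-≤ 1≤T (ℕ.*-mono-≤ 1≤P 1≤P)
    where
    1≤P : 1 ≤ P
    1≤P = ℕ.m^n>0 δ {{>-nonZero 1≤δ}} q
  identity : ∀ A R r T P Q Y Z → A * R * (r * (2 * T * (P * (P * Q) * Y))) + A * R * (Z * (T * (P * P)))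
                                 ≡ (A * (2 * r * Q * Y + Z)) * (R * T * (P * P))
  identity = ℕSolver.solve-∀
  expand : (δ * (δ * 2)) ^ q ≡ P * (P * Q)
  expand = trans (^-distribʳ-* q δ (δ * 2)) (cong (P *_) (^-distribʳ-* q δ 2))
  base : (suc N * 2) ^ r ≤ A * R
  base = begin
    (suc N * 2) ^ r  ≤⟨ ℕ.^-monoˡ-≤ r (ℕ.*-monoˡ-≤ 2 (ℕ.+-monoˡ-≤ N 1≤N)) ⟩
    ((N + N) * 2) ^ r ≡⟨ cong (_^ r) (double² N) ⟩
    (4 * N) ^ r      ≡⟨ ^-distribʳ-* r 4 N ⟩
    A * R            ∎
    where
    double² : ∀ N → (N + N) * 2 ≡ 4 * N
    double² = ℕSolver.solve-∀

module _ (C₁ C₂ r q s b : ℕ) where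

  -- A multiple of `b` and of `r`, so that the bounds for M^b and for T^r can be applied with
  -- integral exponents.
  exponent : ℕ
  exponent = r * (b * s)

  powerConstant : ℕ
  powerConstant = C₁ ^ exponent * (2 ^ (q * (b * s)) * (C₂ * 2 ^ s))

  power-estimate : .{{_ : NonZero r}} .{{_ : NonZero s}} → ∀ {M N T δ a} → 1 ≤ N →
    M ≤ C₁ * (N ^ r * T * (δ ^ q * δ ^ q)) → T ^ r ≤ (N + N) ^ q → δ ^ ((q + q) * exponent) ≤ C₂ * (N + N) ^ s →
    b * (r * r + q) < a * r → M ^ b ≤ powerConstant * N ^ a
  power-estimate {M} {N} {T} {δ} {a} 1≤N M≤ T≤ δ≤ exp< =
    ^-cancelʳ-≤ (M ^ b) (powerConstant * N ^ a) (r * s) {{ℕ.m*n≢0 r s}} (begin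
      (M ^ b) ^ (r * s)
        ≡⟨ trans (ℕ.^-*-assoc M b (r * s)) (cong (M ^_) (order b r s)) ⟩
      M ^ E
        ≤⟨ ℕ.^-monoˡ-≤ E M≤ ⟩
      (C₁ * (N ^ r * T * (δ ^ q * δ ^ q))) ^ E
        ≡⟨ trans (^-distribʳ-* E C₁ _) (cong (C₁ ^ E *_) (trans (^-distribʳ-* E (N ^ r * T) _) (cong (_* (δ ^ q * δ ^ q) ^ E) (^-distribʳ-* E (N ^ r) T)))) ⟩
      C₁ ^ E * ((N ^ r) ^ E * T ^ E * (δ ^ q * δ ^ q) ^ E)
        ≤⟨ ℕ.*-monoʳ-≤ (C₁ ^ E) (ℕ.*-mono-≤ (ℕ.*-mono-≤ (ℕ.≤-reflexive (ℕ.^-*-assoc N r E)) T^E≤) δ^E≤) ⟩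
      C₁ ^ E * (N ^ (r * E) * (2 ^ (q * (b * s)) * N ^ (q * (b * s))) * (C₂ * (2 ^ s * N ^ s)))
        ≡⟨ regroup (C₁ ^ E) (N ^ (r * E)) (2 ^ (q * (b * s))) (N ^ (q * (b * s))) C₂ (2 ^ s) (N ^ s) ⟩
      powerConstant * (N ^ (r * E) * N ^ (q * (b * s)) * N ^ s)
        ≡⟨ cong (powerConstant *_) (trans (ℕ.^-distribˡ-+-* N (r * E + q * (b * s)) s) (cong (_* N ^ s) (ℕ.^-distribˡ-+-* N (r * E) (q * (b * s))))) ⟨
      powerConstant * N ^ (r * E + q * (b * s) + s)
        ≤⟨ ℕ.*-monoʳ-≤ powerConstant (ℕ.^-monoʳ-≤ N {{>-nonZero 1≤N}} exponent≤) ⟩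
      powerConstant * N ^ (a * (r * s))
        -- The constant is raised to the power r s as well, so that a common root can be taken.
        ≤⟨ ℕ.*-mono-≤ (m≤m^n powerConstant (r * s) {{ℕ.m*n≢0 r s}}) (ℕ.≤-reflexive (sym (ℕ.^-*-assoc N a (r * s)))) ⟩
      powerConstant ^ (r * s) * (N ^ a) ^ (r * s)
        ≡⟨ ^-distribʳ-* (r * s) powerConstant (N ^ a) ⟨
      (powerConstant * N ^ a) ^ (r * s) ∎)
    where
    open ≤-Reasoning
    E = exponent
    order : ∀ b r s → b * (r * s) ≡ r * (b * s)
    order = ℕSolver.solve-∀
    regroup : ∀ c n₁ t n₂ d u n₃ → c * (n₁ * (t * n₂) * (d * (u * n₃))) ≡ c * (t * (d * u)) * (n₁ * n₂ * n₃)
    regroup = ℕSolver.solve-∀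
    T^E≤ : T ^ E ≤ 2 ^ (q * (b * s)) * N ^ (q * (b * s))
    T^E≤ = begin
      T ^ E                   ≡⟨ ℕ.^-*-assoc T r (b * s) ⟨
      (T ^ r) ^ (b * s)       ≤⟨ ℕ.^-monoˡ-≤ (b * s) T≤ ⟩
      ((N + N) ^ q) ^ (b * s) ≡⟨ ℕ.^-*-assoc (N + N) q (b * s) ⟩
      (N + N) ^ (q * (b * s)) ≡⟨ twice-^ N (q * (b * s)) ⟩
      2 ^ (q * (b * s)) * N ^ (q * (b * s)) ∎
    δ^E≤ : (δ ^ q * δ ^ q) ^ E ≤ C₂ * (2 ^ s * N ^ s)
    δ^E≤ = begin
      (δ ^ q * δ ^ q) ^ E     ≡⟨ cong (_^ E) (ℕ.^-distribˡ-+-* δ q q) ⟨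
      (δ ^ (q + q)) ^ E       ≡⟨ ℕ.^-*-assoc δ (q + q) E ⟩
      δ ^ ((q + q) * E)       ≤⟨ δ≤ ⟩
      C₂ * (N + N) ^ s        ≡⟨ cong (C₂ *_) (twice-^ N s) ⟩
      C₂ * (2 ^ s * N ^ s)    ∎
    -- The strict inequality `exp<` between integers leaves a gap of at least 1; multiplied by `s`,
    -- it pays for the factor N^s from the divisor bound.
    exponent≤ : r * E + q * (b * s) + s ≤ a * (r * s)
    exponent≤ = begin
      r * E + q * (b * s) + s    ≡⟨ collect r b s q ⟩
      suc (b * (r * r + q)) * s  ≤⟨ ℕ.*-monoˡ-≤ s exp< ⟩
      a * r * s                  ≡⟨ ℕ.*-assoc a r s ⟩
      a * (r * s)                ∎
      where
      collect : ∀ r b s q → r * (r * (b * s)) + q * (b * s) + s ≡ suc (b * (r * r + q)) * s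
      collect = ℕSolver.solve-∀

PowerBound : ℕ → ℕ → ℕ → Set
PowerBound k a b = ∃[ C ] (∀ N → 1 ≤ N → ∀ v l → VCount k N v → LCount k N l → (v ∸ l) ^ b ≤ C * N ^ a)

powerBound : ∀ k r q a b .{{_ : NonZero r}} .{{_ : NonZero q}} .{{_ : NonZero b}} →
  r + q ≡ suc (suc (double k)) → b * (r * r + q) < a * r → PowerBound k a b
powerBound k r@(suc r′) q a b r+q≡n exp< = powerConstant C₁ C₂ r q s b , bound
  where
  n = suc (suc (double k))
  -- The exponent in the bound `B` of `Counting`.
  s = n * r + r * r
  instance
    s≢0 : NonZero s
    s≢0 = >-nonZero (ℕ.≤-trans (s≤s z≤n) (ℕ.m≤n+m (r * r) (n * r)))
    q+q≢0 : NonZero (q + q)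
    q+q≢0 = >-nonZero (ℕ.≤-trans (>-nonZero⁻¹ q) (ℕ.m≤m+n q q))
  -- Every column contributes δ², so the cover contains δ^(2q); this `h` makes its power of order
  -- `exponent` at most C₂ (2N)^s.
  h = (q + q) * (r * (b * s))
  h≢0 : NonZero h
  h≢0 = ℕ.m*n≢0 (q + q) (r * (b * s)) {{q+q≢0}} {{ℕ.m*n≢0 r (b * s) {{_}} {{ℕ.m*n≢0 b s}}}}
  divisors = divisorBound h {{h≢0}}
  C₂ = proj₁ divisors
  C₁ = 4 ^ r * (2 * r * 2 ^ q * n ^ n + r ^ n)
  bound : ∀ N → 1 ≤ N → ∀ v l → VCount k N v → LCount k N l → (v ∸ l) ^ b ≤ powerConstant C₁ C₂ r q s b * N ^ a
  bound N 1≤N v l cV cL with root r ((N + N) ^ q) | proj₂ divisors ((N + N) ^ s) (ℕ.m^n>0 (N + N) {{X≢0}} s)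
    where
    X≢0 : NonZero (N + N)
    X≢0 = >-nonZero (ℕ.≤-trans 1≤N (ℕ.m≤m+n N N))
  ... | T , T^r≤ , T-max | δ , 1≤δ , δ^h≤ , divs = power-estimate C₁ C₂ r q s b {a = a} 1≤N
        (ℕ.≤-trans (count-≤ k N (atMost-nontrivial T-max divs) v l cV cL) (cover-size-≤ r q n 1≤N 1≤T 1≤δ))
        T^r≤ δ^h≤ exp<
    where
    open Counting k r′ q N T δ r+q≡n 1≤N using (atMost-nontrivial; 1≤X^)
    1≤T : 1 ≤ T
    1≤T = T-max 1 (subst (_≤ (N + N) ^ q) (sym (ℕ.^-zeroˡ r)) (1≤X^ q))

-- Rational exponents and the choice of r

toℚᵘ-/ : ∀ i d → toℚᵘ (i / suc d) ℚᵘ.≃ mkℚᵘ i d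
toℚᵘ-/ i d = ℚ.toℚᵘ-fromℚᵘ (mkℚᵘ i d)

toℚᵘ-alphaTerm : ∀ k r′ → toℚᵘ (alphaTerm k r′) ℚᵘ.≃ mkℚᵘ (+ r′) 0 ℚᵘ.+ mkℚᵘ (+ (2 * k + 2)) r′
toℚᵘ-alphaTerm k r′ = ℚᵘ.≃-trans (ℚ.toℚᵘ-homo-+ (+ r′ / 1) _) (ℚᵘ.+-cong (toℚᵘ-/ (+ r′) 0) (toℚᵘ-/ (+ (2 * k + 2)) r′))

alphaTerm<⇒exponent< : ∀ k r′ e → alphaTerm k r′ Q.< e → ↧ₙ e * (r′ * suc r′ + (2 * k + 2)) < ∣ ↥ e ∣ * suc r′
alphaTerm<⇒exponent< k r′ e@record{} α<e = clear (↥ e) cleared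
  where
  b = ↧ₙ e
  M = 2 * k + 2
  raw : (+ r′ ⊛ + suc r′ ⊕ + M ⊛ 1ℤ) ⊛ + b ℤ.< ↥ e ⊛ + (1 * suc r′)
  raw = ℚᵘ.drop-*<* (ℚᵘ.<-respˡ-≃ (toℚᵘ-alphaTerm k r′) (ℚ.toℚᵘ-mono-< α<e))
  numerator : (+ r′ ⊛ + suc r′ ⊕ + M ⊛ 1ℤ) ⊛ + b ≡ + (b * (r′ * suc r′ + M))
  numerator = begin
    (+ r′ ⊛ + suc r′ ⊕ + M ⊛ 1ℤ) ⊛ + b  ≡⟨ cong₂ (λ x y → (x ⊕ y) ⊛ + b) (sym (ℤ.pos-* r′ (suc r′))) (ℤ.*-identityʳ (+ M)) ⟩
    + (r′ * suc r′ + M) ⊛ + b           ≡⟨ ℤ.pos-* (r′ * suc r′ + M) b ⟨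
    + ((r′ * suc r′ + M) * b)           ≡⟨ cong +_ (ℕ.*-comm (r′ * suc r′ + M) b) ⟩
    + (b * (r′ * suc r′ + M))           ∎
    where open ≡-Reasoning
  cleared : + (b * (r′ * suc r′ + M)) ℤ.< ↥ e ⊛ + suc r′
  cleared = subst₂ (λ x y → x ℤ.< ↥ e ⊛ + y) numerator (ℕ.*-identityˡ (suc r′)) raw
  clear : ∀ n {m} → + m ℤ.< n ⊛ + suc r′ → m < ∣ n ∣ * suc r′
  clear (+ a)      {m} lt = ℤ.drop‿+<+ (subst (+ m ℤ.<_) (sym (ℤ.pos-* a (suc r′))) lt)
  clear -[1+ a ]   ()

-- With r = r′ + 1 and q = 2k + 2 - r one has r (r - 1) + 2k + 2 = r² + q, the form used in
-- `powerBound`; the condition on `r′` makes `q` positive.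
exponent<⇒boundedBy : ∀ k r′ e → r′ ≤ 2 * k → ↧ₙ e * (r′ * suc r′ + (2 * k + 2)) < ∣ ↥ e ∣ * suc r′ → BoundedBy k e
exponent<⇒boundedBy k r′ e@record{} r′≤2k exp< = powerBound k (suc r′) q ∣ ↥ e ∣ (↧ₙ e)
  (trans (cong suc (trans (ℕ.+-suc r′ q′) (cong suc (ℕ.m+[n∸m]≡n r′≤2k)))) (cong (λ n → suc (suc n)) 2k≡double))
  (subst (λ x → ↧ₙ e * x < ∣ ↥ e ∣ * suc r′) square exp<)
  where
  q′ = 2 * k ∸ r′
  q = suc q′
  2k≡double : 2 * k ≡ double k
  2k≡double = trans (cong (λ n → k + n) (ℕ.+-identityʳ k)) (sym (double≡+ k))
  square : r′ * suc r′ + (2 * k + 2) ≡ suc r′ * suc r′ + q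
  square = trans (cong (λ n → r′ * suc r′ + (n + 2)) (sym (ℕ.m+[n∸m]≡n r′≤2k))) (identity r′ q′)
    where
    identity : ∀ r′ q′ → r′ * suc r′ + (r′ + q′ + 2) ≡ suc r′ * suc r′ + suc q′
    identity = ℕSolver.solve-∀

alpha-attained : ∀ k → 1 ≤ k → ∃[ r′ ] r′ ≤ 2 * k × alpha k ≡ alphaTerm k r′
alpha-attained k 1≤k with foldr-selective ℚ.⊓-sel (alphaTerm k 1) (map (alphaTerm k) (applyUpTo suc (2 * k)))
-- The initial value of the fold is the term for r = 2, which lies in the range.
... | inj₁ eq = 1 , ℕ.≤-trans 1≤k (ℕ.m≤m+n k (k + 0)) , eq
... | inj₂ α∈ with ∈-map⁻ (alphaTerm k) α∈
...   | r′ , r′∈ , eq with ∈-applyUpTo⁻ suc r′∈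
...     | i , i<2k , refl = r′ , i<2k , eq

-- The bracketing is equivalent to r + M / r ≤ √(4 M + 1) for r = r′ + 1.
optimal-r : ∀ M → ∃[ r′ ] r′ * suc r′ ≤ M × M ≤ suc r′ * suc (suc r′)
optimal-r zero = 0 , z≤n , z≤n
optimal-r (suc M) with optimal-r M
... | r′ , lower , upper with suc M ≤? suc r′ * suc (suc r′)
...   | yes upper′ = r′ , ℕ.m≤n⇒m≤1+n lower , upper′
...   | no ¬upper  = suc r′ , ℕ.<⇒≤ (ℕ.≰⇒> ¬upper) , ℕ.≤-trans (s≤s upper) (subst (suc (suc r′ * suc (suc r′)) ≤_) (identity r′) (ℕ.m≤m+n _ _))
  where
  identity : ∀ r′ → suc (suc r′ * suc (suc r′)) + (3 + 2 * r′) ≡ suc (suc r′) * suc (suc (suc r′))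
  identity = ℕSolver.solve-∀

-- With M = r (r - 1) + i the difference of the two sides is i (2 r - i).
optimal-r-square : ∀ r′ M → r′ * suc r′ ≤ M → M ≤ suc r′ * suc (suc r′) →
  (suc r′ * suc r′ + M) * (suc r′ * suc r′ + M) ≤ (4 * M + 1) * (suc r′ * suc r′)
optimal-r-square r′ M lower upper = subst (λ M → (r * r + M) * (r * r + M) ≤ (4 * M + 1) * (r * r)) (ℕ.m+[n∸m]≡n lower)
  (ℕ.+-cancelʳ-≤ (i * (2 * r)) _ _ (begin
    (r * r + (r′ * r + i)) * (r * r + (r′ * r + i)) + i * (2 * r) ≡⟨ identity r′ i ⟩
    (4 * (r′ * r + i) + 1) * (r * r) + i * i                      ≤⟨ ℕ.+-monoʳ-≤ ((4 * (r′ * r + i) + 1) * (r * r)) (ℕ.*-monoʳ-≤ i i≤2r) ⟩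
    (4 * (r′ * r + i) + 1) * (r * r) + i * (2 * r)                ∎))
  where
  open ≤-Reasoning
  r = suc r′
  i = M ∸ r′ * r
  i≤2r : i ≤ 2 * r
  i≤2r = ℕ.m≤n+o⇒m∸n≤o M (r′ * r) (ℕ.≤-trans upper (ℕ.≤-reflexive (consecutive r′)))
    where
    consecutive : ∀ r′ → suc r′ * suc (suc r′) ≡ r′ * suc r′ + 2 * suc r′
    consecutive = ℕSolver.solve-∀
  identity : ∀ r′ i → let r = suc r′ in
    (r * r + (r′ * r + i)) * (r * r + (r′ * r + i)) + i * (2 * r) ≡ (4 * (r′ * r + i) + 1) * (r * r) + i * i
  identity = ℕSolver.solve-∀

-- Otherwise r′ (r′ + 1) would be at least (2k + 1)(2k + 2), which exceeds 2k + 2.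
optimal-r-≤ : ∀ k r′ → 1 ≤ k → r′ * suc r′ ≤ 2 * k + 2 → r′ ≤ 2 * k
optimal-r-≤ k r′ 1≤k lower = ℕ.≮⇒≥ λ 2k<r′ → ℕ.<⇒≱ (too-large 2k<r′) lower
  where
  open ≤-Reasoning
  too-large : suc (2 * k) ≤ r′ → 2 * k + 2 < r′ * suc r′
  too-large 2k<r′ = begin-strict
    2 * k + 2                        ≡⟨ ℕ.+-comm (2 * k) 2 ⟩
    suc (suc (2 * k))                <⟨ ℕ.m<m*n (suc (suc (2 * k))) 2 (s≤s (s≤s z≤n)) ⟩
    suc (suc (2 * k)) * 2            ≤⟨ ℕ.*-monoʳ-≤ (suc (suc (2 * k))) (s≤s (ℕ.≤-trans 1≤k (ℕ.m≤m+n k (k + 0)))) ⟩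
    suc (suc (2 * k)) * suc (2 * k)  ≤⟨ ℕ.*-mono-≤ (s≤s 2k<r′) 2k<r′ ⟩
    suc r′ * r′                      ≡⟨ ℕ.*-comm (suc r′) r′ ⟩
    r′ * suc r′                      ∎

square-cancel-< : ∀ {m n} → m * m < n * n → m < n
square-cancel-< {m} {n} m²<n² = ℕ.≰⇒> λ n≤m → ℕ.<⇒≱ m²<n² (ℕ.*-mono-≤ n≤m n≤m)

-- In real terms, a / b + 1 > √(4M + 1) ≥ r + M / r. Adding b r to both sides of the goal gives b
-- (r² + M) < (b + a) r, which is proved by comparing squares.
square<⇒exponent< : ∀ r′ M a b → r′ * suc r′ ≤ M → M ≤ suc r′ * suc (suc r′) →
  (4 * M + 1) * (b * b) < (b + a) * (b + a) → b * (r′ * suc r′ + M) < a * suc r′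
square<⇒exponent< r′ M a b lower upper large = ℕ.+-cancelˡ-< (b * r) _ _
  (subst₂ _<_ (expand b r r′ M) (ℕ.*-distribʳ-+ r b a) (square-cancel-< squares))
  where
  open ≤-Reasoning
  r = suc r′
  expand : ∀ b r r′ M → b * (r + r′ * r + M) ≡ b * r + b * (r′ * r + M)
  expand = ℕSolver.solve-∀
  regroup : ∀ b x → b * x * (b * x) ≡ b * b * (x * x)
  regroup = ℕSolver.solve-∀
  regroup′ : ∀ b m r → b * b * (m * (r * r)) ≡ m * (b * b) * (r * r)
  regroup′ = ℕSolver.solve-∀
  regroup″ : ∀ x r → x * x * (r * r) ≡ x * r * (x * r)
  regroup″ = ℕSolver.solve-∀
  squares : b * (r * r + M) * (b * (r * r + M)) < (b + a) * r * ((b + a) * r)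
  squares = begin-strict
    b * (r * r + M) * (b * (r * r + M))     ≡⟨ regroup b (r * r + M) ⟩
    b * b * ((r * r + M) * (r * r + M))     ≤⟨ ℕ.*-monoʳ-≤ (b * b) (optimal-r-square r′ M lower upper) ⟩
    b * b * ((4 * M + 1) * (r * r))         ≡⟨ regroup′ b (4 * M + 1) r ⟩
    (4 * M + 1) * (b * b) * (r * r)         <⟨ ℕ.*-monoˡ-< (r * r) large ⟩
    (b + a) * (b + a) * (r * r)             ≡⟨ regroup″ (b + a) r ⟩
    (b + a) * r * ((b + a) * r)             ∎

square<⇒numerator : ∀ k e → 0ℚ Q.< 1ℚ Q.+ e → (+ (8 * k + 9) / 1) Q.< (1ℚ Q.+ e) Q.* (1ℚ Q.+ e) →
  (8 * k + 9) * (↧ₙ e * ↧ₙ e) < (↧ₙ e + ∣ ↥ e ∣) * (↧ₙ e + ∣ ↥ e ∣)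
square<⇒numerator k e@record{} 0<t n<t² = from-integers (↥ e) positive squares
  where
  b = ↧ₙ e
  t : ℤ
  t = + b ⊕ ↥ e
  t≃ : toℚᵘ (1ℚ Q.+ e) ℚᵘ.≃ mkℚᵘ t (pred b)
  t≃ = ℚᵘ.≃-trans (ℚ.toℚᵘ-homo-+ 1ℚ e) (ℚᵘ.≃-reflexive
    (cong₂ mkℚᵘ (cong₂ _⊕_ (ℤ.*-identityˡ (+ b)) (ℤ.*-identityʳ (↥ e))) (ℕ.+-identityʳ (pred b))))
  positive : 0ℤ ℤ.< t
  positive = subst₂ ℤ._<_ (ℤ.*-zeroˡ (+ b)) (ℤ.*-identityʳ t)
    (ℚᵘ.drop-*<* (ℚᵘ.<-respʳ-≃ t≃ (ℚ.toℚᵘ-mono-< 0<t)))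
  squares : + ((8 * k + 9) * (b * b)) ℤ.< t ⊛ t
  squares = subst₂ ℤ._<_ (sym (ℤ.pos-* (8 * k + 9) (b * b))) (ℤ.*-identityʳ (t ⊛ t))
    (ℚᵘ.drop-*<* (ℚᵘ.<-respʳ-≃ (ℚᵘ.≃-trans (ℚ.toℚᵘ-homo-* (1ℚ Q.+ e) (1ℚ Q.+ e)) (ℚᵘ.*-cong t≃ t≃))
      (ℚᵘ.<-respˡ-≃ (toℚᵘ-/ (+ (8 * k + 9)) 0) (ℚ.toℚᵘ-mono-< n<t²))))
  from-integers : ∀ n → 0ℤ ℤ.< + b ⊕ n → + ((8 * k + 9) * (b * b)) ℤ.< (+ b ⊕ n) ⊛ (+ b ⊕ n) →
                  (8 * k + 9) * (b * b) < (b + ∣ n ∣) * (b + ∣ n ∣)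
  from-integers (+ a) _ lt = ℤ.drop‿+<+ (subst (+ ((8 * k + 9) * (b * b)) ℤ.<_) (sym (ℤ.pos-* (b + a) (b + a))) lt)
  -- If the numerator were negative, t would lie between 0 and b, and t² could not exceed (8k + 9)
  -- b².
  from-integers -[1+ a ] 0<t lt = ⊥-elim (too-small (+ b ⊕ -[1+ a ]) 0<t
      (subst (+ b ⊕ -[1+ a ] ℤ.≤_) (ℤ.+-identityʳ (+ b)) (ℤ.+-monoʳ-≤ (+ b) (ℤ.-≤+ {a}))) lt)
    where
    too-small : ∀ t → 0ℤ ℤ.< t → t ℤ.≤ + b → ¬ (+ ((8 * k + 9) * (b * b)) ℤ.< t ⊛ t)
    too-small (+ A) _ A≤b lt = ℕ.<⇒≱ (ℤ.drop‿+<+ (subst (+ ((8 * k + 9) * (b * b)) ℤ.<_) (sym (ℤ.pos-* A A)) lt))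
      (ℕ.≤-trans (ℕ.*-mono-≤ (ℤ.drop‿+≤+ A≤b) (ℤ.drop‿+≤+ A≤b))
        (ℕ.m≤n*m (b * b) (8 * k + 9) {{>-nonZero (ℕ.≤-trans (s≤s z≤n) (ℕ.m≤n+m 9 (8 * k)))}}))
    too-small -[1+ _ ] () _ _

theorem1p2 : ∀ (k : ℕ) → 2 ≤ k →
    (∀ (ε : ℚ) → 0ℚ Q.< ε → BoundedBy k (alpha k Q.+ ε))
    × (∀ (e : ℚ) → 0ℚ Q.< 1ℚ Q.+ e → (+ (8 * k + 9) / 1) Q.< (1ℚ Q.+ e) Q.* (1ℚ Q.+ e) → BoundedBy k e)
theorem1p2 k 2≤k = with-alpha , with-square-root
  where
  1≤k : 1 ≤ k
  1≤k = ℕ.≤-trans (ℕ.n≤1+n 1) 2≤k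
  with-alpha : ∀ ε → 0ℚ Q.< ε → BoundedBy k (alpha k Q.+ ε)
  with-alpha ε 0<ε with alpha-attained k 1≤k
  ... | r′ , r′≤2k , α≡ = exponent<⇒boundedBy k r′ (alpha k Q.+ ε) r′≤2k
        (alphaTerm<⇒exponent< k r′ (alpha k Q.+ ε)
          (subst₂ Q._<_ (trans (ℚ.+-identityʳ (alpha k)) α≡) refl (ℚ.+-monoʳ-< (alpha k) 0<ε)))
  with-square-root : ∀ e → 0ℚ Q.< 1ℚ Q.+ e → (+ (8 * k + 9) / 1) Q.< (1ℚ Q.+ e) Q.* (1ℚ Q.+ e) → BoundedBy k e
  with-square-root e 0<1+e n<t² with optimal-r (2 * k + 2)
  -- For M = 2k + 2 the number 4M + 1 is 8k + 9, so this r has r - 1 + M / r at most √(8k + 9) - 1.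
  ... | r′ , lower , upper = exponent<⇒boundedBy k r′ e (optimal-r-≤ k r′ 1≤k lower)
        (square<⇒exponent< r′ (2 * k + 2) ∣ ↥ e ∣ (↧ₙ e) lower upper
          (subst (λ n → n * (↧ₙ e * ↧ₙ e) < (↧ₙ e + ∣ ↥ e ∣) * (↧ₙ e + ∣ ↥ e ∣)) (identity k) (square<⇒numerator k e 0<1+e n<t²)))
    where
    identity : ∀ k → 8 * k + 9 ≡ 4 * (2 * k + 2) + 1
    identity = ℕSolver.solve-∀
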